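{- For every graph $G = (V,E)$ and every $\varepsilon > 0$, $\kappa(G) = O(1.6031^{\mathrm{mw}(G)} |V|^{1+\varepsilon})$. That is, for every real $\varepsilon > 0$ there is a constant $c_\varepsilon > 0$ (depending only on $\varepsilon$) such that every finite simple undirected graph $G = (V,E)$ with $V \neq \emptyset$ satisfies $\kappa(G) \le c_\varepsilon \cdot 1.6031^{\mathrm{mw}(G)} \cdot |V|^{1+\varepsilon}$, where $\kappa(G)$ is the number of K-sets of $G$ and $\mathrm{mw}(G)$ is the modular-width of $G$.
   Context: All graphs are finite, simple and undirected. For $v \in V$, $N_G(v) = \{w \in V : \{v,w\} \in E\}$, $N_G[v] = N_G(v) \cup \{v\}$, and for $X \subseteq V$, $N_G[X] = \bigcup_{v \in X} N_G[v]$. A K-set of $G$ is a non-empty subset $W \subseteq V$ such that the induced subgraph $G[W]$ is connected and there is a (possibly empty) independent set $X \subseteq V$ of $G$ with $W = V \setminus N_G[X]$. A set $M \subseteq V$ is a module of $G$ if for every $v \in V \setminus M$, either $M \cap N_G(v) = \emptyset$ or $M \subseteq N_G(v)$. The modular-width $\mathrm{mw}(G)$ is defined recursively as the minimum integer $k \ge 1$ such that at least one of the following holds: (M1) $G$ consists of a single vertex; or (M2) $V$ can be partitioned into non-empty modules $V_1, \ldots, V_{k'}$ of $G$ with $2 \le k' \le k$ such that the modular-width of each $G[V_i]$ is at most $k$. -}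

module Defs where

open import Level using (0ℓ)
open import Data.Bool.Properties using () renaming (_≟_ to _≟ᵇ_)
open import Data.Fin.Base using (Fin)
open import Data.Fin.Properties using (all?; any?)
open import Data.Fin.Subset
open import Data.Fin.Subset.Induction using (Acc; acc; ⊃-wellFounded)
open import Data.Fin.Subset.Properties
  using (_∈?_; _⊆?_; nonempty?; anySubset?; x∈⁅x⁆; x∈⁅y⁆⇒x≡y; p⊆p∪q; q⊆p∪q; x∈p∪q⁻; x∈p∩q⁺)
import Data.Integer.Base as ℤ
open import Data.List.Base as List using (List; []; _∷_; _++_; allFin; filter; length)
open import Data.Nat.Base as ℕ using (ℕ; zero; suc)
open import Data.Product using (_×_; _,_; ∃; ∃₂)
open import Data.Rational as ℚ using (ℚ; 0ℚ; 1ℚ; ↥_; ↧ₙ_)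
import Data.Rational.Properties as ℚₚ
open import Algebra.Definitions.RawSemiring ℚ.+-*-rawSemiring using () renaming (_^_ to _^ℚ_)
open import Data.Sum using (_⊎_; inj₁; inj₂)
open import Data.Vec.Base as Vec using (tabulate)
import Data.Vec.Properties as Vecₚ
open import Relation.Binary.Core using (Rel)
open import Relation.Binary.Definitions using (Decidable)
open import Relation.Binary.Construct.Closure.ReflexiveTransitive using (Star; ε; _◅_; _◅◅_)
open import Relation.Binary.PropositionalEquality using (_≡_; _≢_; refl; sym; subst)
open import Relation.Nullary using (Dec; yes; no; does; ¬_)
open import Relation.Nullary.Decidable using (_×-dec_; _→-dec_; ¬?; map′; decidable-stable)

-- The vertices form a subset V of an ambient Fin n, so that an induced
-- subgraph keeps the names of its vertices.  The number of vertices is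
-- ∣ V ∣, not n.
record Graph (n : ℕ) : Set₁ where
  field
    V        : Subset n
    _~_      : Rel (Fin n) 0ℓ
    _~?_     : Decidable _~_
    ~-sym    : ∀ {v w} → v ~ w → w ~ v
    ~-irrefl : ∀ {v} → ¬ v ~ v
    ~-source : ∀ {v w} → v ~ w → v ∈ V

  N : Fin n → Subset n
  N v = tabulate (λ w → does (v ~? w))

  N[_] : Fin n → Subset n
  N[ v ] = N v ∪ ⁅ v ⁆

  N[_]ˢ : Subset n → Subset n
  N[ X ]ˢ = ⋃ (List.map N[_] (filter (_∈? X) (allFin n)))

  Independent : Subset n → Set
  Independent X = ∀ v w → v ∈ X → w ∈ X → ¬ v ~ w

  Connected : Set
  Connected = ∀ v w → v ∈ V → w ∈ V → Star _~_ v w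

  IsModule : Subset n → Set
  IsModule M = M ⊆ V × (∀ v → v ∈ V → v ∉ M → Empty (M ∩ N v) ⊎ M ⊆ N v)

open Graph using (V)

infixl 8 _[_]

_[_] : ∀ {n} → Graph n → Subset n → Graph n
G [ W ] = record
  { V        = V G ∩ W
  ; _~_      = λ v w → v ~ w × v ∈ W × w ∈ W
  ; _~?_     = λ v w → (v ~? w) ×-dec (v ∈? W) ×-dec (w ∈? W)
  ; ~-sym    = λ (v~w , v∈W , w∈W) → ~-sym v~w , w∈W , v∈W
  ; ~-irrefl = λ (v~v , _) → ~-irrefl v~v
  ; ~-source = λ (v~w , v∈W , _) → x∈p∩q⁺ (~-source v~w , v∈W)
  }
  where
  open Graph G hiding (V)

IsKSet : ∀ {n} → Graph n → Subset n → Set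
IsKSet G W =
  W ⊆ V G × Nonempty W × Graph.Connected (G [ W ]) ×
  ∃ λ X → X ⊆ V G × Graph.Independent G X × W ≡ V G ─ Graph.N[_]ˢ G X

module _ {n} (G : Graph n) where
  open Graph G hiding (V)

  private
    closure : ∀ u S → Acc _⊃_ S → u ∈ S → (∀ {x} → x ∈ S → Star _~_ u x) →
              ∃ λ T → u ∈ T × (∀ {x} → x ∈ T → Star _~_ u x) ×
                      (∀ {x y} → x ∈ T → x ~ y → y ∈ T)
    closure u S (acc rec) u∈S reach
      with any? (λ x → any? (λ y → (x ∈? S) ×-dec (x ~? y) ×-dec ¬? (y ∈? S)))
    ... | no none = S , u∈S , reach , λ {x} {y} x∈S x~y →
            decidable-stable (y ∈? S) (λ y∉S → none (x , y , x∈S , x~y , y∉S))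
    ... | yes (x , y , x∈S , x~y , y∉S) =
            closure u (S ∪ ⁅ y ⁆) (rec (p⊆p∪q ⁅ y ⁆ , y , q⊆p∪q S ⁅ y ⁆ (x∈⁅x⁆ y) , y∉S))
              (p⊆p∪q ⁅ y ⁆ u∈S) reach′
      where
      reach′ : ∀ {z} → z ∈ S ∪ ⁅ y ⁆ → Star _~_ u z
      reach′ {z} z∈ with x∈p∪q⁻ S ⁅ y ⁆ z∈
      ... | inj₁ z∈S = reach z∈S
      ... | inj₂ z∈y = subst (Star _~_ u) (sym (x∈⁅y⁆⇒x≡y y z∈y)) (reach x∈S ◅◅ (x~y ◅ ε))

  star? : Decidable (Star _~_)
  star? u v
    with closure u ⁅ u ⁆ (⊃-wellFounded ⁅ u ⁆) (x∈⁅x⁆ u)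
           (λ {x} x∈u → subst (Star _~_ u) (sym (x∈⁅y⁆⇒x≡y u x∈u)) ε)
  ... | T , u∈T , reach , closed = map′ reach (stays u∈T) (v ∈? T)
    where
    stays : ∀ {x} → x ∈ T → Star _~_ x v → v ∈ T
    stays x∈T ε            = x∈T
    stays x∈T (x~y ◅ y~*v) = stays (closed x∈T x~y) y~*v

  connected? : Dec Connected
  connected? = all? λ v → all? λ w → (v ∈? V G) →-dec (w ∈? V G) →-dec star? v w

  independent? : ∀ X → Dec (Independent X)
  independent? X = all? λ v → all? λ w → (v ∈? X) →-dec (w ∈? X) →-dec ¬? (v ~? w)

isKSet? : ∀ {n} (G : Graph n) W → Dec (IsKSet G W)
isKSet? G W =
  (W ⊆? V G) ×-dec nonempty? W ×-dec connected? (G [ W ]) ×-dec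
  anySubset? λ X → (X ⊆? V G) ×-dec independent? G X ×-dec
                   Vecₚ.≡-dec _≟ᵇ_ W (V G ─ Graph.N[_]ˢ G X)

-- Each subset of Fin n occurs exactly once.
allSubsets : ∀ n → List (Subset n)
allSubsets zero    = Vec.[] ∷ []
allSubsets (suc n) = List.map (inside Vec.∷_)  (allSubsets n)
                  ++ List.map (outside Vec.∷_) (allSubsets n)

κ : ∀ {n} → Graph n → ℕ
κ {n} G = length (filter (isKSet? G) (allSubsets n))

record IsModularPartition {n k} (G : Graph n) (P : Fin k → Subset n) : Set where
  field
    nonempty : ∀ i → Nonempty (P i)
    disjoint : ∀ i j → i ≢ j → Empty (P i ∩ P j)
    covers   : ∀ v → v ∈ V G → ∃ λ i → v ∈ P i
    modules  : ∀ i → Graph.IsModule G (P i)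

-- MW≤ G k says mw(G) ≤ k.  Parts of a partition are strictly smaller than V, so
-- the recursive definition of mw is an induction.  MW≤ G k is monotone in k, so
-- for a part, mw(G[Vᵢ]) ≤ k, i.e. the least j with MW≤ G[Vᵢ] j is ≤ k, is the
-- same as MW≤ G[Vᵢ] k.
data MW≤ {n} (G : Graph n) (k : ℕ) : Set where
  single : 1 ℕ.≤ k → ∣ V G ∣ ≡ 1 → MW≤ G k
  split  : ∀ k′ → 2 ℕ.≤ k′ → k′ ℕ.≤ k →
           (P : Fin k′ → Subset n) → IsModularPartition G P →
           (∀ i → MW≤ (G [ P i ]) k) → MW≤ G k

IsModularWidth : ∀ {n} → Graph n → ℕ → Set
IsModularWidth G k = MW≤ G k × (∀ j → MW≤ G j → k ℕ.≤ j)

-- x is given by its upper cut { q ∈ ℚ | x < q }, an open, inhabited, upward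
-- closed set of positive rationals.  Classically these cuts are exactly the
-- elements of [0,∞); constructively they include all non-negative Dedekind
-- reals.
record ℝ≥0 : Set₁ where
  field
    Above     : ℚ → Set
    positive  : ∀ {q} → Above q → 0ℚ ℚ.< q
    inhabited : ∃ λ q → Above q
    upward    : ∀ {q r} → Above q → q ℚ.≤ r → Above r
    open′     : ∀ {q} → Above q → ∃ λ p → p ℚ.< q × Above p

open ℝ≥0

infix 4 _≤ᴿ_ _<ᴿ_
infixl 6 _+ᴿ_
infixl 7 _*ᴿ_
infixr 8 _^ᴺ_ _^ᴿ_

_≤ᴿ_ : ℝ≥0 → ℝ≥0 → Set
x ≤ᴿ y = ∀ q → Above y q → Above x q

-- Some rational q satisfies x < q ≤ y.
_<ᴿ_ : ℝ≥0 → ℝ≥0 → Set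
x <ᴿ y = ∃ λ q → Above x q × (∀ r → Above y r → q ℚ.≤ r)

fromℚ : (p : ℚ) → .{{ℚ.NonNegative p}} → ℝ≥0
fromℚ p = record
  { Above     = p ℚ.<_
  ; positive  = ℚₚ.≤-<-trans (ℚₚ.nonNegative⁻¹ p)
  ; inhabited = p ℚ.+ 1ℚ , subst (ℚ._< p ℚ.+ 1ℚ) (ℚₚ.+-identityʳ p) (ℚₚ.+-monoʳ-< p (ℚₚ.positive⁻¹ 1ℚ))
  ; upward    = ℚₚ.<-≤-trans
  ; open′     = λ p<q → let (r , p<r , r<q) = ℚₚ.<-dense p<q in r , r<q , p<r
  }

ℕ→ℚ : ℕ → ℚ
ℕ→ℚ n = ℤ.+ n ℚ./ 1

fromℕ : ℕ → ℝ≥0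
fromℕ n = fromℚ (ℕ→ℚ n) {{ℚₚ.normalize-nonNeg n 1}}

_+ᴿ_ : ℝ≥0 → ℝ≥0 → ℝ≥0
x +ᴿ y = record
  { Above     = λ q → ∃₂ λ a b → Above x a × Above y b × a ℚ.+ b ℚ.≤ q
  ; positive  = λ (a , b , x<a , y<b , a+b≤q) →
      ℚₚ.<-≤-trans (ℚₚ.+-mono-< (positive x x<a) (positive y y<b)) a+b≤q
  ; inhabited = let (a , x<a) = inhabited x ; (b , y<b) = inhabited y in
      a ℚ.+ b , a , b , x<a , y<b , ℚₚ.≤-refl
  ; upward    = λ (a , b , x<a , y<b , a+b≤q) q≤r →
      a , b , x<a , y<b , ℚₚ.≤-trans a+b≤q q≤r
  ; open′     = λ (a , b , x<a , y<b , a+b≤q) → let (a′ , a′<a , x<a′) = open′ x x<a in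
      a′ ℚ.+ b , ℚₚ.<-≤-trans (ℚₚ.+-monoˡ-< b a′<a) a+b≤q , a′ , b , x<a′ , y<b , ℚₚ.≤-refl
  }

_*ᴿ_ : ℝ≥0 → ℝ≥0 → ℝ≥0
x *ᴿ y = record
  { Above     = λ q → ∃₂ λ a b → Above x a × Above y b × a ℚ.* b ℚ.≤ q
  ; positive  = λ (a , b , x<a , y<b , ab≤q) →
      ℚₚ.<-≤-trans (subst (ℚ._< a ℚ.* b) (ℚₚ.*-zeroˡ b) (*-monoˡ-< y<b (positive x x<a))) ab≤q
  ; inhabited = let (a , x<a) = inhabited x ; (b , y<b) = inhabited y in
      a ℚ.* b , a , b , x<a , y<b , ℚₚ.≤-refl
  ; upward    = λ (a , b , x<a , y<b , ab≤q) q≤r →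
      a , b , x<a , y<b , ℚₚ.≤-trans ab≤q q≤r
  ; open′     = λ (a , b , x<a , y<b , ab≤q) → let (a′ , a′<a , x<a′) = open′ x x<a in
      a′ ℚ.* b , ℚₚ.<-≤-trans (*-monoˡ-< y<b a′<a) ab≤q , a′ , b , x<a′ , y<b , ℚₚ.≤-refl
  }
  where
  *-monoˡ-< : ∀ {b c d} → Above y b → c ℚ.< d → c ℚ.* b ℚ.< d ℚ.* b
  *-monoˡ-< {b} y<b = ℚₚ.*-monoˡ-<-pos b {{ℚ.positive (positive y y<b)}}

_^ᴺ_ : ℝ≥0 → ℕ → ℝ≥0
x ^ᴺ zero  = fromℕ 1
x ^ᴺ suc k = x *ᴿ x ^ᴺ k

private
  1≤⇒1≤^ : ∀ {t} k → 1ℚ ℚ.≤ t → 1ℚ ℚ.≤ t ^ℚ k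
  1≤⇒≤^ : ∀ {t} k → 1ℚ ℚ.≤ t → t ℚ.≤ t ^ℚ suc k

  1≤⇒1≤^ zero    1≤t = ℚₚ.≤-refl
  1≤⇒1≤^ (suc k) 1≤t = ℚₚ.≤-trans 1≤t (1≤⇒≤^ k 1≤t)

  1≤⇒≤^ {t} k 1≤t = subst (ℚ._≤ t ^ℚ suc k) (ℚₚ.*-identityʳ t)
    (ℚₚ.*-monoˡ-≤-nonNeg t {{ℚ.nonNegative (ℚₚ.≤-trans (ℚₚ.nonNegative⁻¹ 1ℚ) 1≤t)}} (1≤⇒1≤^ k 1≤t))

-- n ^ α is the infimum of n ^ (a / d) over the rationals a / d > α, for n ≥ 1;
-- and n ^ (a / d) ≤ t is n ^ a ≤ t ^ d.
_^ᴿ_ : ℕ → ℝ≥0 → ℝ≥0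
n ^ᴿ α = record
  { Above     = λ q → ∃₂ λ e t → Above α e × 0ℚ ℚ.< t ×
                  ℕ→ℚ (n ℕ.^ ℤ.∣ ↥ e ∣) ℚ.≤ t ^ℚ ↧ₙ e × t ℚ.< q
  ; positive  = λ (_ , _ , _ , 0<t , _ , t<q) → ℚₚ.<-trans 0<t t<q
  ; inhabited = let (e , α<e) = inhabited α
                    m = ℕ→ℚ (n ℕ.^ ℤ.∣ ↥ e ∣)
                    0≤m = ℚₚ.nonNegative⁻¹ m {{ℚₚ.normalize-nonNeg (n ℕ.^ ℤ.∣ ↥ e ∣) 1}}
                    t = 1ℚ ℚ.+ m
                    1≤t = ℚₚ.+-monoʳ-≤ 1ℚ 0≤m
                    m≤t = subst (ℚ._≤ t) (ℚₚ.+-identityˡ m) (ℚₚ.+-monoˡ-≤ m (ℚₚ.nonNegative⁻¹ 1ℚ))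
                in 1ℚ ℚ.+ t , e , t , α<e , ℚₚ.<-≤-trans (ℚₚ.positive⁻¹ 1ℚ) 1≤t ,
                   ℚₚ.≤-trans m≤t (1≤⇒≤^ (ℚ.denominator-1 e) 1≤t) ,
                   subst (ℚ._< 1ℚ ℚ.+ t) (ℚₚ.+-identityˡ t) (ℚₚ.+-monoˡ-< t (ℚₚ.positive⁻¹ 1ℚ))
  ; upward    = λ (e , t , α<e , 0<t , n^e≤t , t<q) q≤r →
      e , t , α<e , 0<t , n^e≤t , ℚₚ.<-≤-trans t<q q≤r
  ; open′     = λ (e , t , α<e , 0<t , n^e≤t , t<q) → let (p , t<p , p<q) = ℚₚ.<-dense t<q in
      p , p<q , e , t , α<e , 0<t , n^e≤t , t<p
  }

{-# OPTIONS --safe #-}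
module Submission where

-- If a K-set W = V \ N[X] meets two parts of a modular partition, then connectivity makes it a union
-- of parts, and it comes from a K-set of the quotient graph; otherwise it is a K-set of G[Vᵢ].  Hence
-- κ(G) is at most the sum of the κ(G[Vᵢ]) plus the number of K-sets of a graph on at most mw(G)
-- vertices, and the decomposition tree has at most |V| - 1 inner nodes.
--
-- On k vertices there are at most k 1.02993^(16k) K-sets.  This is a branching argument over
-- labelings of the vertices by W, X and N = N(X).  Undecided vertices are free (weight 16) or known
-- not to be in X, called red (weight 9).  A free vertex with many undecided neighbours is branched on
-- directly (in X or not).  Otherwise every free neighbour of a red vertex lies in a short path of free
-- vertices: a free vertex without X-neighbours is in X or W, and connectivity of W puts further red
-- vertices into W.  The factor k and the rounding are paid for by 1.02993^16 < 1.6030 < 1.6031.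

open import Defs
open import Algebra.Properties.CommutativeMonoid.Sum
open import Data.Bool.Base using (Bool; true; false; _∧_; _∨_; not; T; if_then_else_)
import Data.Bool.Properties as Boolₚ
open import Data.Empty using (⊥; ⊥-elim)
open import Data.Fin.Base using (Fin; zero; suc)
import Data.Fin.Properties as Finₚ
open import Data.Fin.Subset using (Subset; inside; outside; _∈_; _∉_; _⊆_; _∩_; _─_; ⋃; ∣_∣; Nonempty)
open import Data.Fin.Subset.Properties
  using (_∈?_; _⊆?_; nonempty?; ⊆-antisym; x∈p∩q⁺; x∈p∩q⁻; x∈p∪q⁺; x∈p∪q⁻; x∈⁅x⁆; x∈⁅y⁆⇒x≡y;
         p─q⊆p; x∈p∧x∉q⇒x∈p─q; p⊂q⇒∣p∣<∣q∣; x∈p⇒∣p-x∣<∣p∣; ∉⊥)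
open import Data.Integer.Base as ℤ using (+_)
import Data.Integer.Properties as ℤₚ
open import Data.List.Base as List using (List; []; _∷_; length; filter)
import Data.List.Properties as Listₚ
open import Data.List.Membership.Propositional using () renaming (_∈_ to _∈ˡ_)
open import Data.List.Membership.Propositional.Properties using (∈-allFin; ∈-filter⁺; ∈-filter⁻; ∈-map⁻)
open import Data.List.Relation.Unary.All as All using (All; []; _∷_)
import Data.List.Relation.Unary.All.Properties as Allₚ
open import Data.List.Relation.Unary.AllPairs as AllPairs using (AllPairs; []; _∷_)
import Data.List.Relation.Unary.AllPairs.Properties as AllPairsₚ
open import Data.List.Relation.Unary.Any as Any using (Any; here; there)
import Data.List.Relation.Unary.Any.Properties as Anyₚ
import Data.List.Relation.Unary.Unique.Propositional.Properties as Uniqueₚ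
open import Data.Nat.Base as ℕ hiding (_/_)
open import Data.Nat.Induction using (<-wellFounded)
open import Data.Nat.Properties as ℕₚ
open import Data.Nat.Tactic.RingSolver using (solve-∀)
open import Data.Product using (∃; ∃₂; _×_; _,_; proj₁; proj₂)
open import Data.Rational as ℚ using (ℚ; 0ℚ; 1ℚ; _/_; ↥_; ↧ₙ_)
import Data.Rational.Properties as ℚₚ
import Data.Rational.Unnormalised.Base as ℚᵘ
import Data.Rational.Unnormalised.Properties as ℚᵘₚ
open import Algebra.Definitions.RawSemiring ℚ.+-*-rawSemiring using () renaming (_^_ to _^ℚ_)
open import Data.Sum using (_⊎_; inj₁; inj₂)
open import Data.Unit using (⊤; tt)
import Data.Vec.Base as Vec
import Data.Vec.Properties as Vecₚ
open import Function.Base using (_∘_; case_of_)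
open import Function.Bundles using (Equivalence)
open import Induction.WellFounded using (Acc; acc)
open import Relation.Binary.Construct.Closure.ReflexiveTransitive as Star using (Star; _◅_)
open import Relation.Binary.PropositionalEquality
  using (_≡_; _≢_; refl; sym; trans; cong; cong₂; subst; subst₂)
open import Relation.Nullary using (Dec; yes; no; does; ¬_; contradiction)
open import Relation.Nullary.Decidable
  using (dec-true; dec-false; ¬?; _×-dec_; _⊎-dec_; decidable-stable; toWitness)
open ℝ≥0

-- Finite sums and counting

-- Many sets X yield the same W, so it is W that is counted: the labelings in a list of solutions
-- differ pairwise in W, and a branch may stop as soon as W is determined, with X still open
-- (`leaf`). Connectivity of W is a global condition, while a state records only local information.
-- It enters through one vertex that is guessed to lie in W, which costs the factor k. Any other
-- vertex of W must be joined to that one, so a set of free vertices that meets W has an edge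
-- leading out to an undecided vertex of W (`crossing`). If there is only one possible exit, it is
-- forced into W. The obstacle is an isolated free edge with two red neighbours at one end and none
-- at the other: no exit is forced, and branching on its labels alone exceeds the budget. Such edges
-- are treated jointly around a common red neighbour.

∑ : ∀ {n} → (Fin n → ℕ) → ℕ
∑ = sum +-0-commutativeMonoid

∑-mono-≤ : ∀ {n} {f g : Fin n → ℕ} → (∀ i → f i ≤ g i) → ∑ f ≤ ∑ g
∑-mono-≤ {zero}  f≤g = z≤n
∑-mono-≤ {suc n} f≤g = +-mono-≤ (f≤g zero) (∑-mono-≤ (f≤g ∘ suc))

∑-+ : ∀ {n} (f g : Fin n → ℕ) → ∑ (λ i → f i + g i) ≡ ∑ f + ∑ g
∑-+ = ∑-distrib-+ +-0-commutativeMonoid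

∑-*ˡ : ∀ {n} c (f : Fin n → ℕ) → ∑ (λ i → c * f i) ≡ c * ∑ f
∑-*ˡ {zero}  c f = sym (*-zeroʳ c)
∑-*ˡ {suc n} c f = trans (cong (_+_ (c * f zero)) (∑-*ˡ c (f ∘ suc)))
                         (sym (*-distribˡ-+ c (f zero) (∑ (f ∘ suc))))

∑-const : ∀ n c → ∑ {n} (λ _ → c) ≡ n * c
∑-const zero    c = refl
∑-const (suc n) c = cong (_+_ c) (∑-const n c)

∑-zero : ∀ n → ∑ {n} (λ _ → 0) ≡ 0
∑-zero n = trans (∑-const n 0) (*-zeroʳ n)

∑≡0 : ∀ {n} {f : Fin n → ℕ} → ∑ f ≡ 0 → ∀ i → f i ≡ 0
∑≡0 {suc n} {f} eq zero    = m+n≡0⇒m≡0 (f zero) eq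
∑≡0 {suc n} {f} eq (suc i) = ∑≡0 (m+n≡0⇒n≡0 (f zero) eq) i

bit : Bool → ℕ
bit b = if b then 1 else 0

count : ∀ {n} → (Fin n → Bool) → ℕ
count b = ∑ (bit ∘ b)

_≟ᵇ_ : ∀ {n} → Fin n → Fin n → Bool
i ≟ᵇ j = does (i Finₚ.≟ j)

count-≟ : ∀ {n} (i : Fin n) → count (_≟ᵇ i) ≡ 1
count-≟ {suc n} zero    = cong suc (∑-zero n)
count-≟ {suc n} (suc i) = count-≟ i

_without_ : ∀ {n} → (Fin n → Bool) → Fin n → Fin n → Bool
(b without i) j = b j ∧ not (j ≟ᵇ i)

count-without : ∀ {n} (b : Fin n → Bool) i → b i ≡ true → count b ≡ suc (count (b without i))
count-without b i bi = trans
  (sum-cong-≗ +-0-commutativeMonoid pointwise)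
  (trans (∑-+ (bit ∘ (_≟ᵇ i)) (bit ∘ (b without i))) (cong (_+ count (b without i)) (count-≟ i)))
  where
  pointwise : ∀ j → bit (b j) ≡ bit (j ≟ᵇ i) + bit ((b without i) j)
  pointwise j with j Finₚ.≟ i
  ... | yes refl rewrite bi = refl
  ... | no _ with b j
  ...   | true  = refl
  ...   | false = refl

count≡0 : ∀ {n} {b : Fin n → Bool} → count b ≡ 0 → ∀ i → b i ≢ true
count≡0 {b = b} eq i bi with () ← trans (sym (cong bit bi)) (∑≡0 eq i)

count>0 : ∀ {n} (b : Fin n → Bool) {m} → count b ≡ suc m → ∃ λ i → b i ≡ true × count (b without i) ≡ m
count>0 {n} b {m} eq with Finₚ.any? (λ i → b i Boolₚ.≟ true)
... | yes (i , bi) = i , bi , suc-injective (trans (sym (count-without b i bi)) eq)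
... | no none = contradiction (trans (sym eq) count≡) λ ()
  where
  count≡ : count b ≡ 0
  count≡ = trans
    (sum-cong-≗ +-0-commutativeMonoid (λ i → cong bit (Boolₚ.¬-not {b i} {true} λ bi → none (i , bi))))
    (∑-zero n)

without-true : ∀ {n} (b : Fin n → Bool) i {j} → b j ≡ true → j ≢ i → (b without i) j ≡ true
without-true b i {j} bj j≢i rewrite bj | dec-false (j Finₚ.≟ i) j≢i = refl

without-true⁻ : ∀ {n} (b : Fin n → Bool) i {j} → (b without i) j ≡ true → b j ≡ true × j ≢ i
without-true⁻ b i {j} eq with b j | j Finₚ.≟ i | eq
... | true  | no j≢i | _ = refl , j≢i
... | true  | yes _  | ()
... | false | _      | ()

count≡1 : ∀ {n} (b : Fin n → Bool) → count b ≡ 1 →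
          ∃ λ i → b i ≡ true × (∀ j → b j ≡ true → j ≡ i)
count≡1 b eq with count>0 b eq
... | i , bi , rest = i , bi , unique
  where
  unique : ∀ j → b j ≡ true → j ≡ i
  unique j bj with j Finₚ.≟ i
  ... | yes j≡i = j≡i
  ... | no j≢i = ⊥-elim (count≡0 {b = b without i} rest j (without-true b i bj j≢i))

true⇒count>0 : ∀ {n} (b : Fin n → Bool) {i} → b i ≡ true → 1 ≤ count b
true⇒count>0 b {i} bi = subst (1 ≤_) (sym (count-without b i bi)) (s≤s z≤n)

length-filters : ∀ {A : Set} {P Q R : A → Set} (P? : ∀ x → Dec (P x)) (Q? : ∀ x → Dec (Q x)) (R? : ∀ x → Dec (R x)) xs →
  All (λ x → P x → Q x ⊎ R x) xs → length (filter P? xs) ≤ length (filter Q? xs) + length (filter R? xs)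
length-filters P? Q? R? [] [] = z≤n
length-filters P? Q? R? (x ∷ xs) (px ∷ pxs) with length-filters P? Q? R? xs pxs | P? x | Q? x | R? x
... | ih | no _   | no _  | no _ = ih
... | ih | no _   | yes _ | no _ = m≤n⇒m≤1+n ih
... | ih | no _   | no _  | yes _ = ≤-trans (m≤n⇒m≤1+n ih) (≤-reflexive (sym (+-suc _ _)))
... | ih | no _   | yes _ | yes _ = ≤-trans (m≤n⇒m≤1+n ih) (s≤s (+-monoʳ-≤ (length (filter Q? xs)) (n≤1+n _)))
... | ih | yes _  | yes _ | no _ = s≤s ih
... | ih | yes _  | no _ | yes _ = ≤-trans (s≤s ih) (≤-reflexive (sym (+-suc _ _)))
... | ih | yes _  | yes _ | yes _ = s≤s (≤-trans ih (+-monoʳ-≤ (length (filter Q? xs)) (n≤1+n _)))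
... | ih | yes p  | no ¬q | no ¬r with px p
...   | inj₁ q = contradiction q ¬q
...   | inj₂ r = contradiction r ¬r

-- Applied with `Q` the goal itself: either one neighbour settles a state, or all of them have the
-- exceptional form.
∀-⊎ : ∀ {n} {P : Fin n → Set} {Q : Set} → (∀ i → P i ⊎ Q) → (∀ i → P i) ⊎ Q
∀-⊎ {zero}  h = inj₁ λ ()
∀-⊎ {suc n} h with h zero | ∀-⊎ (h ∘ suc)
... | inj₂ q | _      = inj₂ q
... | inj₁ _ | inj₂ q = inj₂ q
... | inj₁ p | inj₁ f = inj₁ λ { zero → p ; (suc i) → f i }

-- Branching recurrences over the common base p / q

module Bounds (p q : ℕ) .{{_ : NonZero p}} (q≤p : q ≤ p) where

  -- l ≤ (c / 1000) (p / q) ^ m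
  Bound : ℕ → ℕ → ℕ → Set
  Bound c l m = l * q ^ m * 1000 ≤ c * p ^ m

  -- The term `c * (q / p) ^ k` of a branching recurrence, multiplied by `p ^ K`. Subtraction
  -- truncates, hence the side condition `k ≤ K` in `Split`.
  contribution : ℕ → ℕ × ℕ → ℕ
  contribution K (c , k) = c * (q ^ k * p ^ (K ∸ k))

  contributions : ℕ → List (ℕ × ℕ) → ℕ
  contributions K []       = 0
  contributions K (w ∷ ws) = contribution K w + contributions K ws

  -- One branching at weight `m`: a branch has weight `m′` and a guaranteed drop `k`. The true drop
  -- may be larger, so that the `k` can be numerals.
  data Split (K m : ℕ) : ℕ → List (ℕ × ℕ) → Set where
    []  : Split K m 0 []
    add : ∀ {l c k m′ l′ ws} → Bound c l m′ → m′ + k ≤ m → k ≤ K →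
          Split K m l′ ws → Split K m (l + l′) ((c , k) ∷ ws)

  private
    shuffle : ∀ l x y z w → l * (x * y * z) * 1000 * w ≡ (l * x * 1000) * (y * (z * w))
    shuffle = solve-∀

    shuffle′ : ∀ c x y z u v → (c * x) * (y * (z * (u * v))) ≡ c * (z * u) * (x * y * v)
    shuffle′ = solve-∀

  bound-term : ∀ {K m l c k m′} → Bound c l m′ → m′ + k ≤ m → k ≤ K →
               l * q ^ m * 1000 * p ^ K ≤ contribution K (c , k) * p ^ m
  bound-term {K} {m} {l} {c} {k} {m′} lb gain k≤K = begin
    l * q ^ m * 1000 * p ^ K                          ≡⟨ cong (λ h → l * h * 1000 * p ^ K) (power q) ⟩
    l * (q ^ m′ * q ^ j * q ^ k) * 1000 * p ^ K       ≡⟨ shuffle l (q ^ m′) (q ^ j) (q ^ k) (p ^ K) ⟩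
    (l * q ^ m′ * 1000) * (q ^ j * (q ^ k * p ^ K))   ≤⟨ *-mono-≤ lb (*-mono-≤ (^-monoˡ-≤ j q≤p) ≤-refl) ⟩
    (c * p ^ m′) * (p ^ j * (q ^ k * p ^ K))          ≡⟨ cong (λ h → (c * p ^ m′) * (p ^ j * (q ^ k * h))) pK ⟩
    (c * p ^ m′) * (p ^ j * (q ^ k * (p ^ (K ∸ k) * p ^ k)))
                                                      ≡⟨ shuffle′ c (p ^ m′) (p ^ j) (q ^ k) (p ^ (K ∸ k)) (p ^ k) ⟩
    contribution K (c , k) * (p ^ m′ * p ^ j * p ^ k) ≡⟨ cong (contribution K (c , k) *_) (power p) ⟨
    contribution K (c , k) * p ^ m                    ∎
    where
    open ≤-Reasoning
    -- The drop beyond the guaranteed one; it only helps, since `q ^ j ≤ p ^ j`.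
    j = m ∸ (m′ + k)
    m≡ : m ≡ m′ + j + k
    m≡ = trans (sym (m+[n∸m]≡n gain)) (lemma m′ k j)
      where
      lemma : ∀ a b c → a + b + c ≡ a + c + b
      lemma = solve-∀
    power : ∀ b → b ^ m ≡ b ^ m′ * b ^ j * b ^ k
    power b = trans (cong (b ^_) m≡) (trans (^-distribˡ-+-* b (m′ + j) k) (cong (_* b ^ k) (^-distribˡ-+-* b m′ j)))
    pK : p ^ K ≡ p ^ (K ∸ k) * p ^ k
    pK = trans (cong (p ^_) (sym (m∸n+n≡m k≤K))) (^-distribˡ-+-* p (K ∸ k) k)

  bound-split : ∀ {K m l ws} → Split K m l ws →
                l * q ^ m * 1000 * p ^ K ≤ contributions K ws * p ^ m
  bound-split [] = z≤n
  bound-split {K} {m} (add {l} {c} {k} {_} {l′} {ws} lb gain k≤K rest) = begin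
    (l + l′) * q ^ m * 1000 * p ^ K                           ≡⟨ distrib l l′ (q ^ m) (p ^ K) ⟩
    l * q ^ m * 1000 * p ^ K + l′ * q ^ m * 1000 * p ^ K      ≤⟨ +-mono-≤ (bound-term {K} {m} {l} {c} lb gain k≤K) (bound-split rest) ⟩
    contribution K (c , k) * p ^ m + contributions K ws * p ^ m
                                                              ≡⟨ *-distribʳ-+ (p ^ m) (contribution K (c , k)) _ ⟨
    contributions K ((c , k) ∷ ws) * p ^ m                    ∎
    where
    open ≤-Reasoning
    distrib : ∀ a b x y → (a + b) * x * 1000 * y ≡ a * x * 1000 * y + b * x * 1000 * y
    distrib = solve-∀

  -- The factor `p ^ m` separates from the sum, so a single numerical test at `p ^ K` serves all
  -- weights `m`.
  bound-combine : ∀ K {c m l l′ ws} → l ≤ l′ → Split K m l′ ws → contributions K ws ≤ c * p ^ K → Bound c l m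
  bound-combine K {c} {m} {l} {l′} {ws} l≤l′ terms total =
    *-cancelʳ-≤ (l * q ^ m * 1000) (c * p ^ m) (p ^ K) {{m^n≢0 p K}} (begin
      l * q ^ m * 1000 * p ^ K   ≤⟨ *-monoˡ-≤ (p ^ K) (*-monoˡ-≤ 1000 (*-monoˡ-≤ (q ^ m) l≤l′)) ⟩
      l′ * q ^ m * 1000 * p ^ K  ≤⟨ bound-split terms ⟩
      contributions K ws * p ^ m ≤⟨ *-monoˡ-≤ (p ^ m) total ⟩
      c * p ^ K * p ^ m          ≡⟨ lemma c (p ^ K) (p ^ m) ⟩
      c * p ^ m * p ^ K          ∎)
    where
    open ≤-Reasoning
    lemma : ∀ a b c → a * b * c ≡ a * c * b
    lemma = solve-∀

  bound-1 : ∀ m → Bound 1000 1 m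
  bound-1 m = begin
    1 * q ^ m * 1000 ≡⟨ *-comm (1 * q ^ m) 1000 ⟩
    1000 * (1 * q ^ m) ≡⟨ cong (1000 *_) (*-identityˡ (q ^ m)) ⟩
    1000 * q ^ m ≤⟨ *-monoʳ-≤ 1000 (^-monoˡ-≤ m q≤p) ⟩
    1000 * p ^ m ∎
    where open ≤-Reasoning

  bound-mono : ∀ {c c′ l m} → c ≤ c′ → Bound c l m → Bound c′ l m
  bound-mono {m = m} c≤c′ b = ≤-trans b (*-monoˡ-≤ (p ^ m) c≤c′)

  -- Gives all starting states the same exponent, so that their bounds can be added.
  bound-extend : ∀ {l m m′} → Bound 1000 l m → m ≤ m′ → l * q ^ m′ ≤ p ^ m′
  bound-extend {l} {m} {m′} b m≤m′ = *-cancelʳ-≤ (l * q ^ m′) (p ^ m′) 1000 (begin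
    l * q ^ m′ * 1000            ≡⟨ cong (λ h → l * h * 1000) (power q) ⟩
    l * (q ^ m * q ^ j) * 1000   ≡⟨ lemma l (q ^ m) (q ^ j) 1000 ⟩
    l * q ^ m * 1000 * q ^ j     ≤⟨ *-mono-≤ b (^-monoˡ-≤ j q≤p) ⟩
    1000 * p ^ m * p ^ j         ≡⟨ *-assoc 1000 (p ^ m) (p ^ j) ⟩
    1000 * (p ^ m * p ^ j)       ≡⟨ cong (1000 *_) (power p) ⟨
    1000 * p ^ m′                ≡⟨ *-comm 1000 (p ^ m′) ⟩
    p ^ m′ * 1000                ∎)
    where
    open ≤-Reasoning
    j = m′ ∸ m
    power : ∀ b → b ^ m′ ≡ b ^ m * b ^ j
    power b = trans (cong (b ^_) (sym (m+[n∸m]≡n m≤m′))) (^-distribˡ-+-* b m j)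
    lemma : ∀ a b c d → a * (b * c) * d ≡ a * b * d * c
    lemma = solve-∀

-- Bernoulli's inequality, cleared of denominators, and the absorption of a linear factor

bernoulli : ∀ a k → (a + k) * a ^ k ≤ suc a ^ k * a
bernoulli a zero    = ≤-reflexive (trans (*-identityʳ (a + 0)) (trans (+-identityʳ a) (sym (*-identityˡ a))))
bernoulli a (suc k) = begin
  (a + suc k) * (a * a ^ k)        ≡⟨ *-assoc (a + suc k) a (a ^ k) ⟨
  (a + suc k) * a * a ^ k          ≤⟨ *-monoˡ-≤ (a ^ k) (≤-trans (m≤m+n _ k) (≤-reflexive (expand a k))) ⟩
  suc a * (a + k) * a ^ k          ≡⟨ *-assoc (suc a) (a + k) (a ^ k) ⟩
  suc a * ((a + k) * a ^ k)        ≤⟨ *-monoʳ-≤ (suc a) (bernoulli a k) ⟩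
  suc a * (suc a ^ k * a)          ≡⟨ *-assoc (suc a) (suc a ^ k) a ⟨
  suc a ^ suc k * a                ∎
  where
  open ≤-Reasoning
  expand : ∀ a k → (a + suc k) * a + k ≡ suc a * (a + k)
  expand = solve-∀

-- Since `P / Q ≤ a / b` and, by Bernoulli, `k * a ^ k ≤ suc a ^ k * a`, enlarging the base from
-- `a / b` to `suc a / b` pays for the factor `k` at the price of the constant `a`.
absorb-linear-factor : ∀ {Q P b a} .{{_ : NonZero Q}} → P * b ≤ Q * a → ∀ k {l} →
                       l * Q ^ k ≤ k * P ^ k → l * b ^ k ≤ suc a ^ k * a
absorb-linear-factor {Q} {P} {b} {a} Pb≤Qa k {l} l≤ =
  *-cancelʳ-≤ (l * b ^ k) (suc a ^ k * a) (Q ^ k) {{m^n≢0 Q k}} (begin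
    l * b ^ k * Q ^ k          ≡⟨ swap l (b ^ k) (Q ^ k) ⟩
    l * Q ^ k * b ^ k          ≤⟨ *-monoˡ-≤ (b ^ k) l≤ ⟩
    k * P ^ k * b ^ k          ≡⟨ *-assoc k (P ^ k) (b ^ k) ⟩
    k * (P ^ k * b ^ k)        ≡⟨ cong (k *_) (^-distribʳ-* k P b) ⟨
    k * (P * b) ^ k            ≤⟨ *-monoʳ-≤ k (^-monoˡ-≤ k Pb≤Qa) ⟩
    k * (Q * a) ^ k            ≡⟨ cong (k *_) (^-distribʳ-* k Q a) ⟩
    k * (Q ^ k * a ^ k)        ≡⟨ rotate k (Q ^ k) (a ^ k) ⟩
    k * a ^ k * Q ^ k          ≤⟨ *-monoˡ-≤ (Q ^ k) (≤-trans (*-monoˡ-≤ (a ^ k) (m≤n+m k a)) (bernoulli a k)) ⟩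
    suc a ^ k * a * Q ^ k      ∎)
  where
  open ≤-Reasoning
  ^-distribʳ-* : ∀ k x y → (x * y) ^ k ≡ x ^ k * y ^ k
  ^-distribʳ-* zero    x y = refl
  ^-distribʳ-* (suc k) x y = trans (cong (x * y *_) (^-distribʳ-* k x y)) (interchange x y (x ^ k) (y ^ k))
    where
    interchange : ∀ a b c d → a * b * (c * d) ≡ a * c * (b * d)
    interchange = solve-∀
  swap : ∀ a b c → a * b * c ≡ a * c * b
  swap = solve-∀
  rotate : ∀ a b c → a * (b * c) ≡ a * c * b
  rotate = solve-∀

-- Labelings and the branching rules

data Label : Set where
  inW inX inN : Label

_≟ˡ_ : (l l′ : Label) → Dec (l ≡ l′)
inW ≟ˡ inW = yes refl
inW ≟ˡ inX = no λ ()
inW ≟ˡ inN = no λ ()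
inX ≟ˡ inW = no λ ()
inX ≟ˡ inX = yes refl
inX ≟ˡ inN = no λ ()
inN ≟ˡ inW = no λ ()
inN ≟ˡ inX = no λ ()
inN ≟ˡ inN = yes refl

data Status : Set where
  fixed    : Label → Status
  red free : Status

Admits : Status → Label → Set
Admits (fixed l) l′ = l′ ≡ l
Admits red       l′ = l′ ≢ inX
Admits free      l′ = ⊤

admits? : ∀ s l → Dec (Admits s l)
admits? (fixed l) l′ = l′ ≟ˡ l
admits? red       l′ = ¬? (l′ ≟ˡ inX)
admits? free      l′ = yes tt

isFree isRed : Status → Bool
isFree free = true
isFree _    = false
isRed red = true
isRed _   = false

isFree⁻ : ∀ {s} → isFree s ≡ true → s ≡ free
isFree⁻ {free} _ = refl

isRed⁻ : ∀ {s} → isRed s ≡ true → s ≡ red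
isRed⁻ {red} _ = refl

-- A red vertex has lost the label X only. Its weight 9 lets a free vertex that turns red earn 7,
-- which is the profit of the neighbours of a new vertex of W.
weight : Status → ℕ
weight (fixed _) = 0
weight red       = 9
weight free      = 16

forbidX : Status → Status
forbidX free = red
forbidX s    = s

module Counting {n} (_~_ : Fin n → Fin n → Set) (_~?_ : ∀ x y → Dec (x ~ y))
                (~-sym : ∀ {x y} → x ~ y → y ~ x) (~-irrefl : ∀ {x} → ¬ x ~ x) where

  Labeling State : Set
  Labeling = Fin n → Label
  State    = Fin n → Status

  record Valid (ℓ : Labeling) : Set where
    field
      W≁X       : ∀ {x y} → ℓ x ≡ inW → ℓ y ≡ inX → ¬ x ~ y
      X≁X       : ∀ {x y} → ℓ x ≡ inX → ℓ y ≡ inX → ¬ x ~ y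
      N~X       : ∀ {x} → ℓ x ≡ inN → ∃ λ y → x ~ y × ℓ y ≡ inX
      connected : ∀ {x y} → ℓ x ≡ inW → ℓ y ≡ inW →
                  Star (λ a b → a ~ b × ℓ a ≡ inW × ℓ b ≡ inW) x y
  open Valid

  Compat : State → Labeling → Set
  Compat st ℓ = ∀ x → Admits (st x) (ℓ x)

  compat? : ∀ st ℓ → Dec (Compat st ℓ)
  compat? st ℓ = Finₚ.all? λ x → admits? (st x) (ℓ x)

  SameW : Labeling → Labeling → Set
  SameW ℓ ℓ′ = ∀ x → (ℓ x ≡ inW → ℓ′ x ≡ inW) × (ℓ′ x ≡ inW → ℓ x ≡ inW)

  Solutions : State → List Labeling → Set
  Solutions st ls = All Valid ls × All (Compat st) ls × AllPairs (λ ℓ ℓ′ → ¬ SameW ℓ ℓ′) ls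

  μ : State → ℕ
  μ st = ∑ (weight ∘ st)

  -- (p / q) ^ 16 < 1.6030, and the branching vectors below, (7, 57) being the tightest, sum to at most 1.
  p q : ℕ
  p = 102993
  q = 100000

  q≤p : q ≤ p
  q≤p = toWitness {a? = q ≤? p} tt

  open Bounds p q q≤p public

  record Good (c : ℕ) (st : State) : Set where
    constructor good
    field
      bound : ∀ ls → Solutions st ls → Bound c (length ls) (μ st)

  infix 4 _⊑[_]_
  _⊑[_]_ : State → ℕ → State → Set
  s ⊑[ k ] t = μ s + k ≤ μ t

  ⊑-trans : ∀ {s t u k k′} → s ⊑[ k ] t → t ⊑[ k′ ] u → s ⊑[ k + k′ ] u
  ⊑-trans {s} {t} {u} {k} {k′} st tu = begin
    μ s + (k + k′) ≡⟨ +-assoc (μ s) k k′ ⟨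
    μ s + k + k′   ≤⟨ +-monoˡ-≤ k′ st ⟩
    μ t + k′       ≤⟨ tu ⟩
    μ u            ∎
    where open ≤-Reasoning

  ⊑-weaken : ∀ {s t k k′} → k′ ≤ k → s ⊑[ k ] t → s ⊑[ k′ ] t
  ⊑-weaken {s} k′≤k st = ≤-trans (+-monoʳ-≤ (μ s) k′≤k) st

  Branch : Set
  Branch = State × ℕ × ℕ

  Covers : State → List Branch → Set
  Covers st bs = ∀ ℓ → Valid ℓ → Compat st ℓ → Any (λ b → Compat (proj₁ b) ℓ) bs

  -- Powers are compared over the common denominator p ^ K; every drop used is at most K.
  K : ℕ
  K = 100

  smallDrops : List (ℕ × ℕ) → Bool
  smallDrops []             = true
  smallDrops ((_ , k) ∷ ws) = (k ≤ᵇ K) ∧ smallDrops ws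

  -- A record, so that comparing two instances does not unfold the powers of p and q.
  record Affordable (c : ℕ) (ws : List (ℕ × ℕ)) : Set where
    constructor affordable
    field
      check : T (smallDrops ws ∧ (contributions K ws ≤ᵇ c * p ^ K))

  solutions-filter : ∀ {st ls} st′ → Solutions st ls → Solutions st′ (filter (compat? st′) ls)
  solutions-filter {ls = ls} st′ (valid , _ , distinct) =
    Allₚ.filter⁺ (compat? st′) valid ,
    Allₚ.all-filter (compat? st′) ls ,
    AllPairsₚ.filter⁺ (compat? st′) distinct

  coverLength : List Labeling → List Branch → ℕ
  coverLength ls []              = 0
  coverLength ls ((st , _) ∷ bs) = length (filter (compat? st) ls) + coverLength ls bs

  AnyBranch : List Branch → Labeling → Set
  AnyBranch bs ℓ = Any (λ b → Compat (proj₁ b) ℓ) bs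

  anyBranch? : ∀ bs ℓ → Dec (AnyBranch bs ℓ)
  anyBranch? bs ℓ = Any.any? (λ b → compat? (proj₁ b) ℓ) bs

  length-any≤ : ∀ ls bs → length (filter (anyBranch? bs) ls) ≤ coverLength ls bs
  length-any≤ ls []       = ≤-reflexive (cong length (Listₚ.filter-none (anyBranch? []) (All.universal (λ _ ()) ls)))
  length-any≤ ls (b ∷ bs) = ≤-trans
    (length-filters (anyBranch? (b ∷ bs)) (compat? (proj₁ b)) (anyBranch? bs) ls
      (All.universal (λ { _ (here h) → inj₁ h ; _ (there t) → inj₂ t }) ls))
    (+-monoʳ-≤ (length (filter (compat? (proj₁ b)) ls)) (length-any≤ ls bs))

  length-covered : ∀ {ls} bs → All (AnyBranch bs) ls → length ls ≤ coverLength ls bs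
  length-covered {ls} bs covered = ≤-trans
    (≤-reflexive (cong length (sym (Listₚ.filter-all (anyBranch? bs) covered))))
    (length-any≤ ls bs)

  -- Each solution is counted in a branch that admits it. Branches may overlap, as only an upper
  -- bound is sought.
  branch : ∀ {c st} bs → Covers st bs →
           All (λ (st′ , c′ , k) → Good c′ st′ × st′ ⊑[ k ] st) bs →
           Affordable c (List.map proj₂ bs) → Good c st
  branch {c} {st} bs covers goods (affordable cheap) = good bound
    where
    small = proj₁ (Equivalence.to (Boolₚ.T-∧ {smallDrops (List.map proj₂ bs)}) cheap)
    total = proj₂ (Equivalence.to (Boolₚ.T-∧ {smallDrops (List.map proj₂ bs)}) cheap)
    bound : ∀ ls → Solutions st ls → Bound c (length ls) (μ st)
    bound ls sols = bound-combine K {c} {μ st} {length ls} {coverLength ls bs}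
      (length-covered bs (All.zipWith (λ {ℓ} (v , c) → covers ℓ v c) (proj₁ sols , proj₁ (proj₂ sols)))) (splits bs goods small) (≤ᵇ⇒≤ _ _ total)
      where
      splits : ∀ bs → All (λ (st′ , c′ , k) → Good c′ st′ × st′ ⊑[ k ] st) bs →
               T (smallDrops (List.map proj₂ bs)) → Split K (μ st) (coverLength ls bs) (List.map proj₂ bs)
      splits [] [] _ = []
      splits ((st′ , c′ , k) ∷ bs) ((good′ , gain) ∷ goods) t =
        add {c = c′} {m′ = μ st′} (Good.bound good′ _ (solutions-filter st′ sols)) gain
          (≤ᵇ⇒≤ k K (proj₁ ts)) (splits bs goods (proj₂ ts))
        where ts = Equivalence.to (Boolₚ.T-∧ {k ≤ᵇ K}) t

  -- States: assignments, drops in weight and the invariant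

  setX setW : Fin n → State → State
  setX x st z = if z ≟ᵇ x then fixed inX else if does (x ~? z) then fixed inN else st z
  setW x st z = if z ≟ᵇ x then fixed inW else if does (x ~? z) then forbidX (st z) else st z

  assign : Fin n → Status → State → State
  assign x s st z = if z ≟ᵇ x then s else st z

  -- Indexed by the two tests made in `setX` and `setW`, so that matching on it reduces their
  -- conditionals and supplies the propositions together.
  data View (x z : Fin n) : Bool → Bool → Set where
    same  : z ≡ x → View x z true false
    nbr   : z ≢ x → x ~ z → View x z false true
    other : z ≢ x → ¬ x ~ z → View x z false false

  view : ∀ x z → View x z (z ≟ᵇ x) (does (x ~? z))
  view x z with z Finₚ.≟ x | x ~? z
  ... | yes refl | yes x~x = contradiction x~x ~-irrefl
  ... | yes z≡x  | no _    = same z≡x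
  ... | no z≢x   | yes x~z = nbr z≢x x~z
  ... | no z≢x   | no x≁z  = other z≢x x≁z

  freeNbr redNbr : State → Fin n → Fin n → Bool
  freeNbr st x z = does (x ~? z) ∧ isFree (st z)
  redNbr  st x z = does (x ~? z) ∧ isRed (st z)

  freeDeg redDeg : State → Fin n → ℕ
  freeDeg st x = count (freeNbr st x)
  redDeg  st x = count (redNbr st x)

  freeNbr⁻ : ∀ {st} x z → freeNbr st x z ≡ true → x ~ z × st z ≡ free
  freeNbr⁻ x z eq with x ~? z
  ... | yes x~z = x~z , isFree⁻ eq

  redNbr⁻ : ∀ {st} x z → redNbr st x z ≡ true → x ~ z × st z ≡ red
  redNbr⁻ x z eq with x ~? z
  ... | yes x~z = x~z , isRed⁻ eq

  freeNbr⁺ : ∀ {st} {x z} → x ~ z → st z ≡ free → freeNbr st x z ≡ true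
  freeNbr⁺ {x = x} {z} x~z eq rewrite eq | dec-true (x ~? z) x~z = refl

  redNbr⁺ : ∀ {st} {x z} → x ~ z → st z ≡ red → redNbr st x z ≡ true
  redNbr⁺ {x = x} {z} x~z eq rewrite eq | dec-true (x ~? z) x~z = refl

  μ-setX : ∀ {st x} → st x ≡ free → setX x st ⊑[ 16 + (16 * freeDeg st x + 9 * redDeg st x) ] st
  μ-setX {st} {x} stx = ≤-trans (≤-reflexive (sym total)) (∑-mono-≤ pointwise)
    where
    -- The claimed drop is distributed over the vertices as indicators, after which the inequality
    -- holds vertex by vertex.
    own fr rd : Fin n → ℕ
    own z = 16 * bit (z ≟ᵇ x)
    fr z = 16 * bit (freeNbr st x z)
    rd z = 9 * bit (redNbr st x z)
    total : ∑ (λ z → weight (setX x st z) + (own z + (fr z + rd z))) ≡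
            μ (setX x st) + (16 + (16 * freeDeg st x + 9 * redDeg st x))
    total = trans (∑-+ (weight ∘ setX x st) _) (cong (_+_ (μ (setX x st)))
      (trans (∑-+ own _) (cong₂ _+_
        (trans (∑-*ˡ 16 (bit ∘ (_≟ᵇ x))) (cong (16 *_) (count-≟ x)))
        (trans (∑-+ fr rd) (cong₂ _+_ (∑-*ˡ 16 (bit ∘ freeNbr st x)) (∑-*ˡ 9 (bit ∘ redNbr st x)))))))
    pointwise : ∀ z → weight (setX x st z) + (own z + (fr z + rd z)) ≤ weight (st z)
    pointwise z with z ≟ᵇ x | does (x ~? z) | view x z
    ... | _ | _ | same refl rewrite stx = ≤-refl
    ... | _ | _ | other _ _ = ≤-reflexive (+-identityʳ _)
    ... | _ | _ | nbr _ _ with st z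
    ...   | fixed _ = z≤n
    ...   | red     = ≤-refl
    ...   | free    = ≤-refl

  μ-setW : ∀ {st x} → setW x st ⊑[ weight (st x) + 7 * freeDeg st x ] st
  μ-setW {st} {x} = ≤-trans (≤-reflexive (sym total)) (∑-mono-≤ pointwise)
    where
    own fr : Fin n → ℕ
    own z = weight (st x) * bit (z ≟ᵇ x)
    fr z = 7 * bit (freeNbr st x z)
    total : ∑ (λ z → weight (setW x st z) + (own z + fr z)) ≡
            μ (setW x st) + (weight (st x) + 7 * freeDeg st x)
    total = trans (∑-+ (weight ∘ setW x st) _) (cong (_+_ (μ (setW x st)))
      (trans (∑-+ own fr) (cong₂ _+_
        (trans (∑-*ˡ (weight (st x)) (bit ∘ (_≟ᵇ x))) (trans (cong (weight (st x) *_) (count-≟ x)) (*-identityʳ (weight (st x)))))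
        (∑-*ˡ 7 (bit ∘ freeNbr st x)))))
    pointwise : ∀ z → weight (setW x st z) + (own z + fr z) ≤ weight (st z)
    pointwise z with z ≟ᵇ x | does (x ~? z) | view x z
    ... | _ | _ | same refl = ≤-reflexive (trans (+-identityʳ _) (*-identityʳ _))
    ... | _ | _ | other _ _ = ≤-reflexive (trans (cong (_+_ (weight (st z))) (trans (+-identityʳ _) (*-zeroʳ (weight (st x))))) (+-identityʳ _))
    ... | _ | _ | nbr _ _ rewrite *-zeroʳ (weight (st x)) with st z
    ...   | fixed _ = z≤n
    ...   | red     = ≤-refl
    ...   | free    = ≤-refl

  μ-assign : ∀ {st x s k} → weight s + k ≤ weight (st x) → assign x s st ⊑[ k ] st
  μ-assign {st} {x} {s} {k} gain = ≤-trans (≤-reflexive (sym total)) (∑-mono-≤ pointwise)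
    where
    own : Fin n → ℕ
    own z = k * bit (z ≟ᵇ x)
    total : ∑ (λ z → weight (assign x s st z) + own z) ≡ μ (assign x s st) + k
    total = trans (∑-+ (weight ∘ assign x s st) own) (cong (_+_ (μ (assign x s st)))
      (trans (∑-*ˡ k (bit ∘ (_≟ᵇ x))) (trans (cong (k *_) (count-≟ x)) (*-identityʳ k))))
    pointwise : ∀ z → weight (assign x s st z) + own z ≤ weight (st z)
    pointwise z with z Finₚ.≟ x
    ... | yes refl = ≤-trans (≤-reflexive (cong (_+_ (weight s)) (*-identityʳ k))) gain
    ... | no _ = ≤-reflexive (trans (cong (_+_ (weight (st z))) (*-zeroʳ k)) (+-identityʳ _))

  setX-self : ∀ {st} x → setX x st x ≡ fixed inX
  setX-self x rewrite dec-true (x Finₚ.≟ x) refl = refl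

  setX-nbr : ∀ {st x z} → x ~ z → setX x st z ≡ fixed inN
  setX-nbr {x = x} {z} x~z with z ≟ᵇ x | does (x ~? z) | view x z
  ... | _ | _ | same refl    = contradiction x~z ~-irrefl
  ... | _ | _ | nbr _ _      = refl
  ... | _ | _ | other _ x≁z  = contradiction x~z x≁z

  setX-other : ∀ {st x z} → z ≢ x → ¬ x ~ z → setX x st z ≡ st z
  setX-other {x = x} {z} z≢x x≁z rewrite dec-false (z Finₚ.≟ x) z≢x | dec-false (x ~? z) x≁z = refl

  setW-self : ∀ {st} x → setW x st x ≡ fixed inW
  setW-self x rewrite dec-true (x Finₚ.≟ x) refl = refl

  setW-nbr : ∀ {st x z} → x ~ z → setW x st z ≡ forbidX (st z)
  setW-nbr {x = x} {z} x~z with z ≟ᵇ x | does (x ~? z) | view x z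
  ... | _ | _ | same refl    = contradiction x~z ~-irrefl
  ... | _ | _ | nbr _ _      = refl
  ... | _ | _ | other _ x≁z  = contradiction x~z x≁z

  setW-other : ∀ {st x z} → z ≢ x → ¬ x ~ z → setW x st z ≡ st z
  setW-other {x = x} {z} z≢x x≁z rewrite dec-false (z Finₚ.≟ x) z≢x | dec-false (x ~? z) x≁z = refl

  setW-red : ∀ {st x z} → z ≢ x → st z ≡ red → setW x st z ≡ red
  setW-red {st} {x} {z} z≢x stz with z ≟ᵇ x | does (x ~? z) | view x z
  ... | _ | _ | same z≡x     = contradiction z≡x z≢x
  ... | _ | _ | nbr _ _      = cong forbidX stz
  ... | _ | _ | other _ _    = stz

  -- Neighbours of `x` may be overwritten whatever their status: validity leaves them no label but
  -- N.
  compat-setX : ∀ {st ℓ x} → Valid ℓ → Compat st ℓ → ℓ x ≡ inX → Compat (setX x st) ℓ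
  compat-setX {st} {ℓ} {x} v c ℓx z with z ≟ᵇ x | does (x ~? z) | view x z
  ... | _ | _ | same refl = ℓx
  ... | _ | _ | other _ _ = c z
  ... | _ | _ | nbr _ x~z with ℓ z in ℓz
  ...   | inW = contradiction (~-sym x~z) (W≁X v ℓz ℓx)
  ...   | inX = contradiction x~z (X≁X v ℓx ℓz)
  ...   | inN = refl

  admits-forbidX : ∀ s {l} → l ≢ inX → Admits s l → Admits (forbidX s) l
  admits-forbidX (fixed _) _   a = a
  admits-forbidX red       _   a = a
  admits-forbidX free      l≢X _ = l≢X

  compat-setW : ∀ {st ℓ x} → Valid ℓ → Compat st ℓ → ℓ x ≡ inW → Compat (setW x st) ℓ
  compat-setW {st} {ℓ} {x} v c ℓx z with z ≟ᵇ x | does (x ~? z) | view x z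
  ... | _ | _ | same refl = ℓx
  ... | _ | _ | other _ _ = c z
  ... | _ | _ | nbr _ x~z = admits-forbidX (st z) (λ ℓz → W≁X v ℓx ℓz x~z) (c z)

  compat-assign : ∀ {st ℓ x s} → Compat st ℓ → Admits s (ℓ x) → Compat (assign x s st) ℓ
  compat-assign {x = x} c a z with z Finₚ.≟ x
  ... | yes refl = a
  ... | no _     = c z

  -- `start` is where paths inside W lead; `W≁free` makes the vertices by which they leave a free
  -- set undecided; `X~N` keeps the X-neighbour of an undecided vertex free. A vertex fixed in N may
  -- still await its X-neighbour.
  record Inv (st : State) : Set where
    field
      W≁free : ∀ {x y} → st x ≡ fixed inW → x ~ y → st y ≢ free
      X~N    : ∀ {x y} → st x ≡ fixed inX → x ~ y → st y ≡ fixed inN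
      start  : ∃ λ v → st v ≡ fixed inW
  open Inv

  Undecided : Status → Set
  Undecided s = ∀ l → s ≢ fixed l

  free-undecided : ∀ {s} → s ≡ free → Undecided s
  free-undecided refl l ()

  red-undecided : ∀ {s} → s ≡ red → Undecided s
  red-undecided refl l ()

  inv-setX : ∀ {st x} → st x ≡ free → Inv st → Inv (setX x st)
  inv-setX {st} {x} stx inv .W≁free {a} {b} sa a~b sb
    with a ≟ᵇ x | does (x ~? a) | view x a | b ≟ᵇ x | does (x ~? b) | view x b | sa | sb
  ... | _ | _ | other _ _ | _ | _ | other _ _ | sa | sb = W≁free inv sa a~b sb
  inv-setX {st} {x} stx inv .X~N {a} {b} sa a~b
    with a ≟ᵇ x | does (x ~? a) | view x a | b ≟ᵇ x | does (x ~? b) | view x b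
  ... | _ | _ | same refl | _ | _ | same refl   = contradiction a~b ~-irrefl
  ... | _ | _ | same refl | _ | _ | other _ x≁b = contradiction a~b x≁b
  ... | _ | _ | _         | _ | _ | nbr _ _     = refl
  ... | _ | _ | other _ x≁a | _ | _ | same refl = contradiction (~-sym a~b) x≁a
  ... | _ | _ | other _ _ | _ | _ | other _ _   = X~N inv sa a~b
  inv-setX {st} {x} stx inv .start with start inv
  -- The old start is untouched: it is not adjacent to the free vertex `x`.
  ... | v , stv = v , trans (setX-other {st} v≢x x≁v) stv
    where
    v≢x : v ≢ x
    v≢x refl = case trans (sym stv) stx of λ ()
    x≁v : ¬ x ~ v
    x≁v x~v = W≁free inv stv (~-sym x~v) stx

  forbidX≢free : ∀ s → forbidX s ≢ free
  forbidX≢free (fixed _) ()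
  forbidX≢free red ()
  forbidX≢free free ()

  forbidX-fixed : ∀ s {l} → forbidX s ≡ fixed l → s ≡ fixed l
  forbidX-fixed (fixed _) eq = eq

  inv-setW : ∀ {st x} → Undecided (st x) → Inv st → Inv (setW x st)
  inv-setW {st} {x} stx inv .W≁free {a} {b} sa a~b sb
    with a ≟ᵇ x | does (x ~? a) | view x a | b ≟ᵇ x | does (x ~? b) | view x b | sa | sb
  ... | _ | _ | _         | _ | _ | nbr _ _   | sa | sb = forbidX≢free (st b) sb
  ... | _ | _ | same refl | _ | _ | other _ x≁b | sa | sb = x≁b a~b
  ... | _ | _ | nbr _ _   | _ | _ | other _ _ | sa | sb = W≁free inv (forbidX-fixed (st a) sa) a~b sb
  ... | _ | _ | other _ _ | _ | _ | other _ _ | sa | sb = W≁free inv sa a~b sb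
  inv-setW {st} {x} stx inv .X~N {a} {b} sa a~b
    with a ≟ᵇ x | does (x ~? a) | view x a | b ≟ᵇ x | does (x ~? b) | view x b | sa
  ... | _ | _ | nbr _ x~a | _ | _ | same refl   | sa = contradiction (X~N inv (forbidX-fixed (st a) sa) a~b) (stx inN)
  ... | _ | _ | other _ _ | _ | _ | same refl   | sa = contradiction (X~N inv sa a~b) (stx inN)
  ... | _ | _ | nbr _ _   | _ | _ | nbr _ _     | sa = cong forbidX (X~N inv (forbidX-fixed (st a) sa) a~b)
  ... | _ | _ | other _ _ | _ | _ | nbr _ _     | sa = cong forbidX (X~N inv sa a~b)
  ... | _ | _ | nbr _ _   | _ | _ | other _ _   | sa = X~N inv (forbidX-fixed (st a) sa) a~b
  ... | _ | _ | other _ _ | _ | _ | other _ _   | sa = X~N inv sa a~b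
  inv-setW {st} {x} stx inv .start = x , setW-self {st} x

  inv-assign : ∀ {st x s} → Undecided (st x) → s ≢ free → s ≢ fixed inW → s ≢ fixed inX →
               Inv st → Inv (assign x s st)
  inv-assign {st} {x} {s} stx s≢free s≢W s≢X inv .W≁free {a} {b} sa a~b sb with a Finₚ.≟ x | b Finₚ.≟ x
  ... | yes _ | _     = s≢W sa
  ... | no _  | yes _ = s≢free sb
  ... | no _  | no _  = W≁free inv sa a~b sb
  inv-assign {st} {x} {s} stx s≢free s≢W s≢X inv .X~N {a} {b} sa a~b with a Finₚ.≟ x | b Finₚ.≟ x
  ... | yes _ | _        = contradiction sa s≢X
  ... | no _  | yes refl = contradiction (X~N inv sa a~b) (stx inN)
  ... | no _  | no _     = X~N inv sa a~b
  inv-assign {st} {x} {s} stx s≢free s≢W s≢X inv .start with start inv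
  ... | v , stv = v , lemma
    where
    lemma : assign x s st v ≡ fixed inW
    lemma with v Finₚ.≟ x
    ... | yes refl = contradiction stv (stx inW)
    ... | no _     = stv

  -- The neighbour labeled X is not yet fixed: the neighbours of a fixed X are fixed.
  N⇒freeX : ∀ {st ℓ x} → Inv st → Valid ℓ → Compat st ℓ → Undecided (st x) → ℓ x ≡ inN →
            ∃ λ y → x ~ y × st y ≡ free × ℓ y ≡ inX
  N⇒freeX {st} {ℓ} {x} inv v c und ℓx with N~X v ℓx
  ... | y , x~y , ℓy with st y in sty | c y
  ...   | free      | _  = y , x~y , sty , ℓy
  ...   | red       | cy = contradiction ℓy cy
  ...   | fixed inW | cy = case trans (sym ℓy) cy of λ ()
  ...   | fixed inN | cy = case trans (sym ℓy) cy of λ ()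
  ...   | fixed inX | cy = contradiction (X~N inv sty (~-sym x~y)) (und inN)

  -- The path in W from `x` to the start leaves `S`, since the start is fixed and `S` is free. The
  -- first vertex outside is not fixed in W, because `W≁free` keeps such vertices away from `S`.
  crossing : ∀ {st ℓ x} (S : Fin n → Bool) → Inv st → Valid ℓ → Compat st ℓ →
             (∀ z → S z ≡ true → st z ≡ free) → S x ≡ true → ℓ x ≡ inW →
             ∃ λ a → ∃ λ b → S a ≡ true × S b ≡ false × a ~ b × ℓ b ≡ inW × (st b ≡ red ⊎ st b ≡ free)
  crossing {st} {ℓ} {x} S inv v c S-free Sx ℓx with start inv
  ... | w , stw = walk Sx (connected v ℓx ℓw)
    where
    ℓw : ℓ w ≡ inW
    ℓw = subst (λ s → Admits s (ℓ w)) stw (c w)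
    walk : ∀ {a} → S a ≡ true → Star (λ a b → a ~ b × ℓ a ≡ inW × ℓ b ≡ inW) a w →
           ∃ λ a → ∃ λ b → S a ≡ true × S b ≡ false × a ~ b × ℓ b ≡ inW × (st b ≡ red ⊎ st b ≡ free)
    walk {a} Sa Star.ε = case trans (sym stw) (S-free a Sa) of λ ()
    walk {a} Sa (_◅_ {j = b} (a~b , _ , ℓb) rest) with S b in Sb
    ... | true  = walk Sb rest
    ... | false = a , b , Sa , Sb , a~b , ℓb , undecided
      where
      undecided : st b ≡ red ⊎ st b ≡ free
      undecided with st b in stb | c b
      ... | red       | _  = inj₁ refl
      ... | free      | _  = inj₂ refl
      ... | fixed inX | cb = case trans (sym ℓb) cb of λ ()
      ... | fixed inN | cb = case trans (sym ℓb) cb of λ ()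
      ... | fixed inW | cb = contradiction (S-free a Sa) (W≁free inv stb (~-sym a~b))

  -- Branching rules at a single vertex

  IH : State → Set
  IH st = ∀ st′ → Inv st′ → μ st′ < μ st → Good 1000 st′

  by-IH : ∀ {st st′ k} .{{_ : NonZero k}} → IH st → Inv st′ → st′ ⊑[ k ] st → Good 1000 st′ × st′ ⊑[ k ] st
  by-IH {st} {st′} {suc k} ih inv gain =
    ih st′ inv (≤-trans (s≤s (m≤m+n (μ st′) k)) (≤-trans (≤-reflexive (sym (+-suc (μ st′) k))) gain)) , gain

  setX-gain : ∀ {st x} i j → st x ≡ free → i ≤ freeDeg st x → j ≤ redDeg st x →
              setX x st ⊑[ 16 + (16 * i + 9 * j) ] st
  setX-gain {st} {x} i j stx i≤ j≤ = ⊑-weaken {setX x st} {st}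
    (+-monoʳ-≤ 16 (+-mono-≤ (*-monoʳ-≤ 16 i≤) (*-monoʳ-≤ 9 j≤))) (μ-setX stx)

  setW-gain : ∀ {st x s} i → st x ≡ s → i ≤ freeDeg st x → setW x st ⊑[ weight s + 7 * i ] st
  setW-gain {st} {x} i refl i≤ = ⊑-weaken {setW x st} {st} (+-monoʳ-≤ (weight (st x)) (*-monoʳ-≤ 7 i≤)) (μ-setW {st} {x})

  _then_ : ∀ {s t u k k′} → t ⊑[ k ] u → s ⊑[ k′ ] t → s ⊑[ k′ + k ] u
  _then_ {s} {t} {u} tu st = ⊑-trans {s} {t} {u} st tu

  -- The label N would require an X-neighbour, and by `N⇒freeX` that neighbour would be free.
  label-X∨W : ∀ {st ℓ x} → Inv st → Valid ℓ → Compat st ℓ → Undecided (st x) →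
              (∀ z → freeNbr st x z ≡ true → ℓ z ≢ inX) → ℓ x ≡ inX ⊎ ℓ x ≡ inW
  label-X∨W {st} {ℓ} {x} inv v c und none with ℓ x in ℓx
  ... | inX = inj₁ refl
  ... | inW = inj₂ refl
  ... | inN with N⇒freeX inv v c und ℓx
  ...   | z , x~z , stz , ℓz = contradiction ℓz (none z (freeNbr⁺ {st} x~z stz))

  label-pair : ∀ {st ℓ x y} → Inv st → Valid ℓ → Compat st ℓ → Undecided (st x) →
               (∀ z → freeNbr st x z ≡ true → z ≡ y) → ℓ x ≡ inX ⊎ ℓ y ≡ inX ⊎ (ℓ x ≡ inW × ℓ y ≢ inX)
  label-pair {st} {ℓ} {x} {y} inv v c und only with ℓ y ≟ˡ inX
  ... | yes ℓy = inj₂ (inj₁ ℓy)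
  ... | no ℓy≢X with label-X∨W inv v c und (λ z h → subst (λ z → ℓ z ≢ inX) (sym (only z h)) ℓy≢X)
  ...   | inj₁ ℓx = inj₁ ℓx
  ...   | inj₂ ℓx = inj₂ (inj₂ (ℓx , ℓy≢X))

  setW² : ∀ {st ℓ x y} → Valid ℓ → Compat st ℓ → ℓ x ≡ inW → ℓ y ≡ inW → Compat (setW y (setW x st)) ℓ
  setW² {st} {ℓ} {x} v c ℓx ℓy = compat-setW {setW x st} v (compat-setW {st} v c ℓx) ℓy

  -- `crossing` is applied to the set of all free vertices: without red vertices a path in W could
  -- not leave it, so W contains no undecided vertex.
  same-W : ∀ {st ℓ} → Inv st → (∀ z → st z ≢ red) → Valid ℓ → Compat st ℓ →
           ∀ z → ℓ z ≡ inW → st z ≡ fixed inW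
  same-W {st} {ℓ} inv noRed v c z ℓz with st z in stz | c z
  ... | fixed l | cz = cong fixed (trans (sym cz) ℓz)
  ... | red     | _  = contradiction stz (noRed z)
  ... | free    | _
    with crossing {st} (isFree ∘ st) inv v c (λ _ → isFree⁻) (cong isFree stz) ℓz
  ...   | a , b , _ , Sb , _ , _ , inj₁ r = contradiction r (noRed b)
  ...   | a , b , _ , Sb , _ , _ , inj₂ f = case trans (sym Sb) (cong isFree f) of λ ()

  leaf : ∀ {st} → Inv st → (∀ z → st z ≢ red) → Good 1000 st
  leaf {st} inv noRed = good bound
    where
    transfer : ∀ {ℓ ℓ′} → Valid ℓ → Compat st ℓ → Compat st ℓ′ → ∀ z → ℓ z ≡ inW → ℓ′ z ≡ inW
    transfer {ℓ} {ℓ′} v c c′ z ℓz = subst (λ s → Admits s (ℓ′ z)) (same-W inv noRed v c z ℓz) (c′ z)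
    bound : ∀ ls → Solutions st ls → Bound 1000 (length ls) (μ st)
    bound [] _ = z≤n
    bound (ℓ ∷ []) _ = bound-1 (μ st)
    bound (ℓ ∷ ℓ′ ∷ ls) (v ∷ v′ ∷ _ , c ∷ c′ ∷ _ , (differ ∷ _) ∷ _) =
      contradiction (λ z → transfer v c c′ z , transfer v′ c′ c z) differ

  -- Being red, `u` is not in X; having no free neighbour, it is not in N. The constant `c` is a
  -- parameter because the drop of 9 is what starts the recursion over gadgets.
  rule-forced : ∀ {st u} → Inv st → IH st → st u ≡ red → freeDeg st u ≡ 0 →
                ∀ {c} → Affordable c ((1000 , 9) ∷ []) → Good c st
  rule-forced {st} {u} inv ih stu f≡0 = branch ((setW u st , 1000 , 9) ∷ []) covers
    (by-IH ih (inv-setW (red-undecided stu) inv) (setW-gain 0 stu z≤n) ∷ [])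
    where
    covers : Covers st _
    covers ℓ v c with label-X∨W inv v c (red-undecided stu) (λ z h → ⊥-elim (count≡0 {b = freeNbr st u} f≡0 z h))
    ... | inj₁ ℓu = contradiction ℓu (subst (λ s → Admits s (ℓ u)) stu (c u))
    ... | inj₂ ℓu = here (compat-setW v c ℓu)

  -- The drop 51 is 9 + 6 · 7. Six neighbours are needed: for five, the vector (44, 9) sums to more
  -- than 1.
  rule-hub : ∀ {st u} → Inv st → IH st → st u ≡ red → 6 ≤ freeDeg st u → Good 1000 st
  rule-hub {st} {u} inv ih stu f≥6 =
    branch ((setW u st , 1000 , 51) ∷ (assign u (fixed inN) st , 1000 , 9) ∷ []) covers
      (by-IH ih (inv-setW (red-undecided stu) inv) (setW-gain 6 stu f≥6) ∷
       by-IH ih (inv-assign (red-undecided stu) (λ ()) (λ ()) (λ ()) inv)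
         (μ-assign (subst (λ s → 9 ≤ weight s) (sym stu) ≤-refl)) ∷ []) (affordable tt)
    where
    covers : Covers st _
    covers ℓ v c with ℓ u in ℓu
    ... | inW = here (compat-setW v c ℓu)
    ... | inX = contradiction ℓu (subst (λ s → Admits s (ℓ u)) stu (c u))
    ... | inN = there (here (compat-assign {st} c ℓu))

  -- 57 = 16 + 2 · 16 + 9 is what two free neighbours and a red one guarantee. The other branch
  -- earns 16 - 9.
  rule-X? : ∀ {st x} → Inv st → IH st → st x ≡ free → setX x st ⊑[ 57 ] st → Good 1000 st
  rule-X? {st} {x} inv ih stx gain =
    branch ((setX x st , 1000 , 57) ∷ (assign x red st , 1000 , 7) ∷ []) covers
      (by-IH ih (inv-setX stx inv) gain ∷
       by-IH ih (inv-assign (free-undecided stx) (λ ()) (λ ()) (λ ()) inv)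
         (μ-assign (subst (λ s → 16 ≤ weight s) (sym stx) ≤-refl)) ∷ []) (affordable tt)
    where
    covers : Covers st _
    covers ℓ v c with ℓ x ≟ˡ inX
    ... | yes ℓx = here (compat-setX v c ℓx)
    ... | no ℓx  = there (here (compat-assign {st} c ℓx))

  singleton-free : ∀ {st : State} x → st x ≡ free → ∀ z → (z ≟ᵇ x) ≡ true → st z ≡ free
  singleton-free x stx z eq with z Finₚ.≟ x
  ... | yes refl = stx

  ≟ᵇ-refl : ∀ (x : Fin n) → (x ≟ᵇ x) ≡ true
  ≟ᵇ-refl x = dec-true (x Finₚ.≟ x) refl

  ≟ᵇ⁻ : ∀ (z x : Fin n) → (z ≟ᵇ x) ≡ true → z ≡ x
  ≟ᵇ⁻ z x eq with z Finₚ.≟ x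
  ... | yes z≡x = z≡x

  -- `crossing` for the set that consists of `x` alone.
  W-neighbour : ∀ {st ℓ x} → Inv st → Valid ℓ → Compat st ℓ → st x ≡ free → ℓ x ≡ inW →
                ∃ λ b → ℓ b ≡ inW × (redNbr st x b ≡ true ⊎ freeNbr st x b ≡ true)
  W-neighbour {st} {ℓ} {x} inv v c stx ℓx
    with crossing (_≟ᵇ x) inv v c (singleton-free {st} x stx) (≟ᵇ-refl x) ℓx
  ... | a , b , Sa , _ , a~b , ℓb , und with ≟ᵇ⁻ a x Sa
  ...   | refl with und
  ...     | inj₁ r = b , ℓb , inj₁ (redNbr⁺ {st} a~b r)
  ...     | inj₂ f = b , ℓb , inj₂ (freeNbr⁺ {st} a~b f)

  red≢free : ∀ {st : State} {a b} → st a ≡ red → st b ≡ free → a ≢ b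
  red≢free sa sb refl with () ← trans (sym sa) sb

  -- Without free neighbours `x` is not in N. If it is in W, then its single red neighbour is the
  -- only way to the start and joins W, so both branches drop 16 + 9.
  rule-pendant : ∀ {st x} → Inv st → IH st → st x ≡ free → freeDeg st x ≡ 0 → redDeg st x ≡ 1 → Good 1000 st
  rule-pendant {st} {x} inv ih stx f≡0 a≡1 with count≡1 (redNbr st x) a≡1
  ... | u , xu , only = branch ((setX x st , 1000 , 25) ∷ (setW u (setW x st) , 1000 , 25) ∷ []) covers
      (by-IH ih (inv-setX stx inv) (setX-gain 0 1 stx z≤n (≤-reflexive (sym a≡1))) ∷
       by-IH ih (inv-setW (red-undecided stu′) (inv-setW (free-undecided stx) inv))
         (_then_ {setW u (setW x st)} {setW x st} {st} (setW-gain 0 stx z≤n) (setW-gain 0 stu′ z≤n)) ∷ []) (affordable tt)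
    where
    stu = proj₂ (redNbr⁻ {st} x u xu)
    stu′ : setW x st u ≡ red
    stu′ = setW-red {st} (red≢free {st} stu stx) stu
    covers : Covers st _
    covers ℓ v c with label-X∨W inv v c (free-undecided stx) (λ z h → ⊥-elim (count≡0 {b = freeNbr st x} f≡0 z h))
    ... | inj₁ ℓx = here (compat-setX v c ℓx)
    ... | inj₂ ℓx with W-neighbour inv v c stx ℓx
    ...   | b , ℓb , inj₂ fb = ⊥-elim (count≡0 {b = freeNbr st x} f≡0 b fb)
    ...   | b , ℓb , inj₁ rb with only b rb
    ...     | refl = there (here (setW² v c ℓx ℓb))

  -- With several red neighbours `x` in W forces none of them, but `x` in X puts at least two of
  -- them into N.
  rule-isolated : ∀ {st x} → Inv st → IH st → st x ≡ free → freeDeg st x ≡ 0 → 2 ≤ redDeg st x → Good 1000 st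
  rule-isolated {st} {x} inv ih stx f≡0 a≥2 =
    branch ((setX x st , 1000 , 34) ∷ (setW x st , 1000 , 16) ∷ []) covers
      (by-IH ih (inv-setX stx inv) (setX-gain 0 2 stx z≤n a≥2) ∷
       by-IH ih (inv-setW (free-undecided stx) inv) (setW-gain 0 stx z≤n) ∷ []) (affordable tt)
    where
    covers : Covers st _
    covers ℓ v c with label-X∨W inv v c (free-undecided stx) (λ z h → ⊥-elim (count≡0 {b = freeNbr st x} f≡0 z h))
    ... | inj₁ ℓx = here (compat-setX v c ℓx)
    ... | inj₂ ℓx = there (here (compat-setW v c ℓx))

  -- Free vertices with exactly one free neighbour

  record Leg (st : State) (x y : Fin n) : Set where
    field
      x-free : st x ≡ free
      y-free : st y ≡ free
      x~y    : x ~ y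
      only-y : ∀ z → freeNbr st x z ≡ true → z ≡ y

    f≥1 : 1 ≤ freeDeg st x
    f≥1 = true⇒count>0 (freeNbr st x) (freeNbr⁺ {st} x~y y-free)

    setW-y : setW x st y ≡ red
    setW-y = trans (setW-nbr {st} x~y) (cong forbidX y-free)

  leg : ∀ {st x} → st x ≡ free → freeDeg st x ≡ 1 → ∃ λ y → Leg st x y
  leg {st} {x} stx f≡1 with count≡1 (freeNbr st x) f≡1
  ... | y , xy , only = y , record
    { x-free = stx
    ; y-free = proj₂ (freeNbr⁻ {st} x y xy)
    ; x~y = proj₁ (freeNbr⁻ {st} x y xy)
    ; only-y = only
    }

  -- `x` is in N only if `y` is in X. In the branch that puts `x` into W, `y` turns red, whence 23 =
  -- 16 + 7.
  rule-leg : ∀ {st x y} → Leg st x y → Inv st → IH st → ∀ k k′ .{{_ : NonZero k}} .{{_ : NonZero k′}} →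
             setX y st ⊑[ k ] st → setX x st ⊑[ k′ ] st →
             Affordable 1000 ((1000 , k) ∷ (1000 , k′) ∷ (1000 , 23) ∷ []) → Good 1000 st
  rule-leg {st} {x} {y} l inv ih k k′ gy gx =
    branch ((setX y st , 1000 , k) ∷ (setX x st , 1000 , k′) ∷ (setW x st , 1000 , 23) ∷ []) covers
      (by-IH ih (inv-setX y-free inv) gy ∷
       by-IH ih (inv-setX x-free inv) gx ∷
       by-IH ih (inv-setW (free-undecided x-free) inv) (setW-gain 1 x-free f≥1) ∷ [])
    where
    open Leg l
    covers : Covers st _
    covers ℓ v c with label-pair inv v c (free-undecided x-free) only-y
    ... | inj₁ ℓx                = there (here (compat-setX v c ℓx))
    ... | inj₂ (inj₁ ℓy)         = here (compat-setX v c ℓy)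
    ... | inj₂ (inj₂ (ℓx , _))   = there (there (here (compat-setW v c ℓx)))

  module IsolatedEdge {st x y} (lx : Leg st x y) (ly : Leg st y x) (inv : Inv st) where
    open Leg lx

    WW-gain : setW y (setW x st) ⊑[ 32 ] st
    WW-gain = _then_ {setW y (setW x st)} {setW x st} {st} (setW-gain 1 x-free f≥1) (setW-gain 0 setW-y z≤n)

    WW-inv : Inv (setW y (setW x st))
    WW-inv = inv-setW (red-undecided setW-y) (inv-setW (free-undecided x-free) inv)

    -- Each end is the other's only possible X-neighbour, so if neither is in X, neither is in N.
    edge-labels : ∀ {ℓ} → Valid ℓ → Compat st ℓ → ℓ x ≡ inX ⊎ ℓ y ≡ inX ⊎ (ℓ x ≡ inW × ℓ y ≡ inW)
    edge-labels v c with label-pair inv v c (free-undecided x-free) only-y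
    ... | inj₁ ℓx        = inj₁ ℓx
    ... | inj₂ (inj₁ ℓy) = inj₂ (inj₁ ℓy)
    ... | inj₂ (inj₂ (ℓx , ℓy≢X)) with label-pair inv v c (free-undecided y-free) (Leg.only-y ly)
    ...   | inj₁ ℓy              = contradiction ℓy ℓy≢X
    ...   | inj₂ (inj₁ ℓx′)      = case trans (sym ℓx) ℓx′ of λ ()
    ...   | inj₂ (inj₂ (ℓy , _)) = inj₂ (inj₂ (ℓx , ℓy))

  -- An end in X decides both ends and a red neighbour, 41 = 16 + 16 + 9; both ends in W give 16 +
  -- 16.
  rule-edge : ∀ {st x y} → Leg st x y → Leg st y x → Inv st → IH st → 1 ≤ redDeg st x → 1 ≤ redDeg st y → Good 1000 st
  rule-edge {st} {x} {y} lx ly inv ih ax ay =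
    branch ((setX x st , 1000 , 41) ∷ (setX y st , 1000 , 41) ∷ (setW y (setW x st) , 1000 , 32) ∷ []) covers
      (by-IH ih (inv-setX x-free inv) (setX-gain 1 1 x-free f≥1 ax) ∷
       by-IH ih (inv-setX y-free inv) (setX-gain 1 1 y-free (Leg.f≥1 ly) ay) ∷
       by-IH ih WW-inv WW-gain ∷ []) (affordable tt)
    where
    open Leg lx
    open IsolatedEdge lx ly inv
    covers : Covers st _
    covers ℓ v c with edge-labels v c
    ... | inj₁ ℓx                 = here (compat-setX v c ℓx)
    ... | inj₂ (inj₁ ℓy)          = there (here (compat-setX v c ℓy))
    ... | inj₂ (inj₂ (ℓx , ℓy))   = there (there (here (setW² v c ℓx ℓy)))

  -- If both ends are in W, then `u` is the only exit from the edge and joins W; `crossing` is used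
  -- for the pair. Without this extra 9 the vector (41, 32, 32) would exceed 1.
  rule-tail : ∀ {st x y} → Leg st x y → Leg st y x → Inv st → IH st → redDeg st x ≡ 1 → redDeg st y ≡ 0 → Good 1000 st
  rule-tail {st} {x} {y} lx ly inv ih ax ay with count≡1 (redNbr st x) ax
  ... | u , xu , only-u =
    branch ((setX x st , 1000 , 41) ∷ (setX y st , 1000 , 32) ∷ (setW u (setW y (setW x st)) , 1000 , 41) ∷ []) covers
      (by-IH ih (inv-setX x-free inv) (setX-gain 1 1 x-free f≥1 (≤-reflexive (sym ax))) ∷
       by-IH ih (inv-setX y-free inv) (setX-gain 1 0 y-free (Leg.f≥1 ly) z≤n) ∷
       by-IH ih (inv-setW (red-undecided stu′) WW-inv)
         (_then_ {setW u (setW y (setW x st))} {setW y (setW x st)} {st} WW-gain (setW-gain 0 stu′ z≤n)) ∷ []) (affordable tt)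
    where
    open Leg lx
    open IsolatedEdge lx ly inv
    stu = proj₂ (redNbr⁻ {st} x u xu)
    stu′ : setW y (setW x st) u ≡ red
    stu′ = setW-red {setW x st} (red≢free {st} stu y-free) (setW-red {st} (red≢free {st} stu x-free) stu)
    S : Fin n → Bool
    S z = (z ≟ᵇ x) ∨ (z ≟ᵇ y)
    S⁻ : ∀ z → S z ≡ true → z ≡ x ⊎ z ≡ y
    S⁻ z eq with z Finₚ.≟ x | z Finₚ.≟ y
    ... | yes z≡x | _       = inj₁ z≡x
    ... | no _    | yes z≡y = inj₂ z≡y
    Sx : S x ≡ true
    Sx = cong (_∨ (x ≟ᵇ y)) (≟ᵇ-refl x)
    Sy : S y ≡ true
    Sy = trans (cong ((y ≟ᵇ x) ∨_) (≟ᵇ-refl y)) (Boolₚ.∨-zeroʳ _)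
    S-free : ∀ z → S z ≡ true → st z ≡ free
    S-free z eq with S⁻ z eq
    ... | inj₁ refl = x-free
    ... | inj₂ refl = y-free
    u∈W : ∀ {ℓ} → Valid ℓ → Compat st ℓ → ℓ x ≡ inW → ℓ u ≡ inW
    u∈W {ℓ} v c ℓx with crossing S inv v c S-free Sx ℓx
    ... | a , b , Sa , Sb , a~b , ℓb , und with S⁻ a Sa | und
    ...   | inj₁ refl | inj₁ r = subst (λ b → ℓ b ≡ inW) (only-u b (redNbr⁺ {st} a~b r)) ℓb
    ...   | inj₁ refl | inj₂ f with only-y b (freeNbr⁺ {st} a~b f)
    ...     | refl = case trans (sym Sb) Sy of λ ()
    u∈W {ℓ} v c ℓx | a , b , Sa , Sb , a~b , ℓb , und | inj₂ refl | inj₁ r = ⊥-elim (count≡0 {b = redNbr st a} ay b (redNbr⁺ {st} a~b r))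
    u∈W {ℓ} v c ℓx | a , b , Sa , Sb , a~b , ℓb , und | inj₂ refl | inj₂ f with Leg.only-y ly b (freeNbr⁺ {st} a~b f)
    ...     | refl = case trans (sym Sb) Sx of λ ()
    covers : Covers st _
    covers ℓ v c with edge-labels v c
    ... | inj₁ ℓx                 = here (compat-setX v c ℓx)
    ... | inj₂ (inj₁ ℓy)          = there (here (compat-setX v c ℓy))
    ... | inj₂ (inj₂ (ℓx , ℓy))   = there (there (here (compat-setW v (setW² v c ℓx ℓy) (u∈W v c ℓx))))

  module Path {st x y z u} (l : Leg st x y) (inv : Inv st) (ih : IH st)
              (fy : freeDeg st y ≡ 2) (ax : redDeg st x ≡ 1)
              (z≢x : z ≢ x) (yz : freeNbr st y z ≡ true) (x-or-z : ∀ w → freeNbr st y w ≡ true → w ≡ x ⊎ w ≡ z)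
              (xu : redNbr st x u ≡ true) (only-u : ∀ w → redNbr st x w ≡ true → w ≡ u) where
    open Leg l

    private
      y~z = proj₁ (freeNbr⁻ {st} y z yz)
      z-free = proj₂ (freeNbr⁻ {st} y z yz)
      u-red = proj₂ (redNbr⁻ {st} x u xu)
      u≢x = red≢free {st} u-red x-free
      u≢z = red≢free {st} u-red z-free

      x≁z : ¬ x ~ z
      x≁z x~z with only-y z (freeNbr⁺ {st} x~z z-free)
      ... | refl = ~-irrefl y~z

      data Labels (ℓ : Labeling) : Set where
        X∋x   : ℓ x ≡ inX → Labels ℓ
        X∋y   : ℓ y ≡ inX → Labels ℓ
        W∋x,y : ℓ x ≡ inW → ℓ y ≡ inW → Labels ℓ
        W∋x,u : ℓ x ≡ inW → ℓ z ≡ inX → ℓ u ≡ inW → Labels ℓ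

      -- If `x` is in W and `y` in N, the X-neighbour of `y` can only be `z`, and the path in W from
      -- `x` to the start can only pass through `u`.
      labels : ∀ {ℓ} → Valid ℓ → Compat st ℓ → Labels ℓ
      labels {ℓ} v c with label-pair inv v c (free-undecided x-free) only-y
      ... | inj₁ ℓx        = X∋x ℓx
      ... | inj₂ (inj₁ ℓy) = X∋y ℓy
      ... | inj₂ (inj₂ (ℓx , ℓy≢X)) with ℓ y in ℓy
      ...   | inW = W∋x,y ℓx ℓy
      ...   | inX = contradiction refl ℓy≢X
      ...   | inN = W∋x,u ℓx ℓz ℓu
        where
        ℓz : ℓ z ≡ inX
        ℓz with N⇒freeX inv v c (free-undecided y-free) ℓy
        ... | w , y~w , stw , ℓw with x-or-z w (freeNbr⁺ {st} y~w stw)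
        ...   | inj₁ refl = case trans (sym ℓx) ℓw of λ ()
        ...   | inj₂ refl = ℓw
        ℓu : ℓ u ≡ inW
        ℓu with W-neighbour inv v c x-free ℓx
        ... | b , ℓb , inj₁ rb = subst (λ b → ℓ b ≡ inW) (only-u b rb) ℓb
        ... | b , ℓb , inj₂ fb with only-y b fb
        ...   | refl = case trans (sym ℓy) ℓb of λ ()

      s₁ s₂ s₃ s₃′ s₄ : State
      s₁ = setX x st
      s₂ = setX y st
      s₃ = setW y (setW x st)
      s₃′ = setW z s₃
      s₄ = setW u (setW x (setX z st))

      item₁ : Good 1000 s₁ × s₁ ⊑[ 41 ] st
      item₁ = by-IH ih (inv-setX x-free inv) (setX-gain 1 1 x-free f≥1 (≤-reflexive (sym ax)))

      item₂ : Good 1000 s₂ × s₂ ⊑[ 48 ] st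
      item₂ = by-IH ih (inv-setX y-free inv) (setX-gain 2 0 y-free (≤-reflexive (sym fy)) z≤n)

      inv₃ : Inv s₃
      inv₃ = inv-setW (red-undecided setW-y) (inv-setW (free-undecided x-free) inv)

      z-free₁ : setW x st z ≡ free
      z-free₁ = trans (setW-other {st} z≢x x≁z) z-free

      -- 23 for `x` in W, then 9 for `y`, and 7 for `z`, which turns red.
      gain₃ : s₃ ⊑[ 39 ] st
      gain₃ = _then_ {s₃} {setW x st} {st} (setW-gain 1 x-free f≥1)
        (setW-gain 1 setW-y (true⇒count>0 (freeNbr (setW x st) y) (freeNbr⁺ {setW x st} y~z z-free₁)))

      z-red₃ : s₃ z ≡ red
      z-red₃ = trans (setW-nbr {setW x st} y~z) (cong forbidX z-free₁)

      item₃′ : Good 1000 s₃′ × s₃′ ⊑[ 48 ] st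
      item₃′ = by-IH ih (inv-setW (red-undecided z-red₃) inv₃)
        (_then_ {s₃′} {s₃} {st} gain₃ (setW-gain 0 z-red₃ z≤n))

      x-free₄ : setX z st x ≡ free
      x-free₄ = trans (setX-other {st} (z≢x ∘ sym) (x≁z ∘ ~-sym)) x-free

      item₄ : ¬ u ~ z → ∀ k .{{_ : NonZero k}} → setX z st ⊑[ k ] st → Good 1000 s₄ × s₄ ⊑[ 9 + (16 + k) ] st
      item₄ u≁z k gain = by-IH ih
        (inv-setW (red-undecided u-red₄) (inv-setW (free-undecided x-free₄) (inv-setX z-free inv)))
        (_then_ {s₄} {setW x (setX z st)} {st}
          (_then_ {setW x (setX z st)} {setX z st} {st} gain (setW-gain 0 x-free₄ z≤n))
          (setW-gain 0 u-red₄ z≤n))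
        where
        u-red₄ : setW x (setX z st) u ≡ red
        u-red₄ = setW-red {setX z st} u≢x (trans (setX-other {st} u≢z (u≁z ∘ ~-sym)) u-red)

      compat₄ : ∀ {ℓ} → Valid ℓ → Compat st ℓ → ℓ x ≡ inW → ℓ z ≡ inX → ℓ u ≡ inW → Compat s₄ ℓ
      compat₄ v c ℓx ℓz ℓu = setW² {setX z st} v (compat-setX {st} v c ℓz) ℓx ℓu

      z≥1 : 1 ≤ freeDeg st z
      z≥1 = true⇒count>0 (freeNbr st z) (freeNbr⁺ {st} (~-sym y~z) y-free)

    good-path : Good 1000 st
    good-path with u ~? z
    -- `u` in W and `z` in X are not adjacent in a valid labeling, so the fourth case is void.
    ... | yes u~z = branch ((s₁ , 1000 , 41) ∷ (s₂ , 1000 , 48) ∷ (s₃ , 1000 , 39) ∷ []) covers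
                      (item₁ ∷ item₂ ∷ by-IH ih inv₃ gain₃ ∷ []) (affordable tt)
      where
      covers : Covers st _
      covers ℓ v c with labels v c
      ... | X∋x ℓx         = here (compat-setX v c ℓx)
      ... | X∋y ℓy         = there (here (compat-setX v c ℓy))
      ... | W∋x,y ℓx ℓy    = there (there (here (setW² v c ℓx ℓy)))
      ... | W∋x,u ℓx ℓz ℓu = contradiction u~z (W≁X v ℓu ℓz)
    ... | no u≁z with freeDeg st z ≤? 1
    ...   | no f≰1 = branch ((s₁ , 1000 , 41) ∷ (s₂ , 1000 , 48) ∷ (s₃ , 1000 , 39) ∷ (s₄ , 1000 , 73) ∷ []) covers
                      (item₁ ∷ item₂ ∷ by-IH ih inv₃ gain₃ ∷
                       item₄ u≁z 48 (setX-gain 2 0 z-free (≰⇒> f≰1) z≤n) ∷ []) (affordable tt)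
      where
      covers : Covers st _
      covers ℓ v c with labels v c
      ... | X∋x ℓx         = here (compat-setX v c ℓx)
      ... | X∋y ℓy         = there (here (compat-setX v c ℓy))
      ... | W∋x,y ℓx ℓy    = there (there (here (setW² v c ℓx ℓy)))
      ... | W∋x,u ℓx ℓz ℓu = there (there (there (here (compat₄ v c ℓx ℓz ℓu))))
    -- Now `s₄` drops only 57, and with 39 for `s₃` the sum would exceed 1. But `y` is the only free
    -- neighbour of `z`, so `y` in W forces `z` into W as well, for 9 more.
    ...   | yes f≤1 = branch ((s₁ , 1000 , 41) ∷ (s₂ , 1000 , 48) ∷ (s₃′ , 1000 , 48) ∷ (s₄ , 1000 , 57) ∷ []) covers
                      (item₁ ∷ item₂ ∷ item₃′ ∷
                       item₄ u≁z 32 (setX-gain 1 0 z-free z≥1 z≤n) ∷ []) (affordable tt)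
      where
      only-y-z : ∀ w → freeNbr st z w ≡ true → w ≡ y
      only-y-z w zw with count≡1 (freeNbr st z) (≤-antisym f≤1 z≥1)
      ... | _ , _ , unique = trans (unique w zw) (sym (unique y (freeNbr⁺ {st} (~-sym y~z) y-free)))
      covers : Covers st _
      covers ℓ v c with labels v c
      ... | X∋x ℓx         = here (compat-setX v c ℓx)
      ... | X∋y ℓy         = there (here (compat-setX v c ℓy))
      ... | W∋x,u ℓx ℓz ℓu = there (there (there (here (compat₄ v c ℓx ℓz ℓu))))
      ... | W∋x,y ℓx ℓy with label-pair inv v c (free-undecided z-free) only-y-z
      ...   | inj₁ ℓz              = contradiction y~z (W≁X v ℓy ℓz)
      ...   | inj₂ (inj₁ ℓy′)      = case trans (sym ℓy) ℓy′ of λ ()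
      ...   | inj₂ (inj₂ (ℓz , _)) = there (there (here (compat-setW {s₃} v (setW² v c ℓx ℓy) ℓz)))

  rule-path : ∀ {st x y} → Leg st x y → Inv st → IH st → freeDeg st y ≡ 2 → redDeg st x ≡ 1 → Good 1000 st
  rule-path {st} {x} {y} l inv ih fy ax
    with count≡1 (redNbr st x) ax | count≡1 (freeNbr st y without x) rest
    where
    open Leg l
    rest : count (freeNbr st y without x) ≡ 1
    rest = suc-injective (trans (sym (count-without (freeNbr st y) x (freeNbr⁺ {st} (~-sym x~y) x-free))) fy)
  ... | u , xu , only-u | z , yz , only-z =
    Path.good-path l inv ih fy ax (proj₂ (without-true⁻ (freeNbr st y) x yz)) (proj₁ (without-true⁻ (freeNbr st y) x yz))
      x-or-z xu only-u
    where
    x-or-z : ∀ w → freeNbr st y w ≡ true → w ≡ x ⊎ w ≡ z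
    x-or-z w yw with w Finₚ.≟ x
    ... | yes w≡x = inj₁ w≡x
    ... | no w≢x  = inj₂ (only-z w (without-true (freeNbr st y) x yw w≢x))

  -- Gadgets: isolated free edges with two red neighbours at one end only

  record Gadget (st : State) (x : Fin n) : Set where
    field
      tip    : Fin n
      leg-x  : Leg st x tip
      leg-y  : Leg st tip x
      two    : redDeg st x ≡ 2
      none   : redDeg st tip ≡ 0

  -- The effect of the two branches that keep `x` out of X: the edge is decided and everything else,
  -- in particular the red vertex and its other gadgets, stays as it was.
  record Removed (st st′ : State) (x y : Fin n) : Set where
    field
      x-decided : ∃ λ l → st′ x ≡ fixed l
      y-decided : ∃ λ l → st′ y ≡ fixed l
      agree     : ∀ z → z ≢ x → z ≢ y → st′ z ≡ st z

  module GadgetStep {st u x} (inv : Inv st) (stu : st u ≡ red) (ux : freeNbr st u x ≡ true) (g : Gadget st x) where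
    open Gadget g renaming (tip to y)
    open Leg leg-x

    no-red-y : ∀ z → y ~ z → st z ≢ red
    no-red-y z y~z stz = count≡0 {b = redNbr st y} none z (redNbr⁺ {st} y~z stz)

    free-nbr-x : ∀ {z} → st z ≡ free → x ~ z → z ≡ y
    free-nbr-x stz x~z = only-y _ (freeNbr⁺ {st} x~z stz)

    free-nbr-y : ∀ {z} → st z ≡ free → y ~ z → z ≡ x
    free-nbr-y stz y~z = Leg.only-y leg-y _ (freeNbr⁺ {st} y~z stz)

    y≁u : ¬ y ~ u
    y≁u y~u = no-red-y u y~u stu

    -- Every neighbour of `y` other than `x` is already fixed in N: the invariant excludes X and W
    -- next to the free vertex `y`, and the gadget excludes red and free.
    setX-removed : Removed st (setX y st) x y
    setX-removed = record
      { x-decided = inN , setX-nbr {st} (~-sym x~y)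
      ; y-decided = inX , setX-self {st} y
      ; agree = agree
      }
      where
      agree : ∀ z → z ≢ x → z ≢ y → setX y st z ≡ st z
      agree z z≢x z≢y = by-adjacency (y ~? z)
        where
        stz-N : y ~ z → st z ≡ fixed inN
        by-adjacency : Dec (y ~ z) → setX y st z ≡ st z
        by-adjacency (no y≁z)  = setX-other {st} z≢y y≁z
        by-adjacency (yes y~z) = trans (setX-nbr {st} y~z) (sym (stz-N y~z))
        stz-N y~z with st z in eq
        ... | fixed inN = refl
        ... | fixed inX = contradiction (trans (sym y-free) (X~N inv eq (~-sym y~z))) λ ()
        ... | fixed inW = contradiction y-free (W≁free inv eq (~-sym y~z))
        ... | red       = contradiction eq (no-red-y z y~z)
        ... | free      = contradiction (free-nbr-y eq y~z) z≢x

    -- `setW` alters only free neighbours, and the two ends have none but each other.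
    setW-removed : Removed st (setW y (setW x st)) x y
    setW-removed = record
      { x-decided = inW , trans (setW-nbr {setW x st} (~-sym x~y)) (cong forbidX (setW-self {st} x))
      ; y-decided = inW , setW-self {setW x st} y
      ; agree = λ z z≢x z≢y → trans
          (step {setW x st} y z z≢y λ stz y~z → z≢x (free-nbr-y (trans (sym (agree-x z z≢x z≢y)) stz) y~z))
          (agree-x z z≢x z≢y)
      }
      where
      step : ∀ {st} x z → z ≢ x → (st z ≡ free → ¬ x ~ z) → setW x st z ≡ st z
      step {st} x z z≢x h = by-adjacency (x ~? z)
        where
        unchanged : x ~ z → ∀ s → s ≡ st z → forbidX s ≡ s
        unchanged x~z (fixed _) _ = refl
        unchanged x~z red       _ = refl
        unchanged x~z free     eq = contradiction x~z (h (sym eq))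
        by-adjacency : Dec (x ~ z) → setW x st z ≡ st z
        by-adjacency (no x≁z)  = setW-other {st} z≢x x≁z
        by-adjacency (yes x~z) = trans (setW-nbr {st} x~z) (unchanged x~z (st z) refl)
      agree-x : ∀ z → z ≢ x → z ≢ y → setW x st z ≡ st z
      agree-x z z≢x z≢y = step {st} x z z≢x λ stz x~z → z≢y (free-nbr-x stz x~z)

    module _ {st′} (removed : Removed st st′ x y) where
      open Removed removed

      status-cong : ∀ z → ¬ x ~ z → ¬ y ~ z → (φ : Status → Bool) → ∀ w →
                    (does (z ~? w) ∧ φ (st′ w)) ≡ (does (z ~? w) ∧ φ (st w))
      status-cong z x≁z y≁z φ w with z ~? w
      ... | no _    = refl
      ... | yes z~w = cong φ (agree w (λ { refl → x≁z (~-sym z~w) }) (λ { refl → y≁z (~-sym z~w) }))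

      degree-cong : ∀ z → ¬ x ~ z → ¬ y ~ z → (φ : Status → Bool) →
                    count (λ w → does (z ~? w) ∧ φ (st′ w)) ≡ count (λ w → does (z ~? w) ∧ φ (st w))
      degree-cong z x≁z y≁z φ = sum-cong-≗ +-0-commutativeMonoid λ w → cong bit (status-cong z x≁z y≁z φ w)

      leg-cong : ∀ {a b} → a ≢ x → a ≢ y → ¬ x ~ a → ¬ y ~ a → Leg st a b → Leg st′ a b
      leg-cong {a} {b} a≢x a≢y x≁a y≁a l = record
        { x-free = trans (agree a a≢x a≢y) (Leg.x-free l)
        ; y-free = trans (agree b (λ { refl → x≁a (~-sym (Leg.x~y l)) }) (λ { refl → y≁a (~-sym (Leg.x~y l)) }))
                     (Leg.y-free l)
        ; x~y = Leg.x~y l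
        ; only-y = λ z h → Leg.only-y l z (trans (sym (status-cong a x≁a y≁a isFree z)) h)
        }

      not-nbrs : ∀ {z} → st z ≡ free → z ≢ x → z ≢ y → ¬ x ~ z × ¬ y ~ z
      not-nbrs stz z≢x z≢y = (λ x~z → z≢y (free-nbr-x stz x~z)) , (λ y~z → z≢x (free-nbr-y stz y~z))

      -- The ends of another gadget are free, hence not adjacent to `x` or `y`, whose only free
      -- neighbours are each other. So the statuses around them do not change.
      gadget-cong : ∀ {z} → z ≢ x → z ≢ y → Gadget st z → Gadget st′ z
      gadget-cong {z} z≢x z≢y h = record
        { tip = t
        ; leg-x = leg-cong z≢x z≢y x≁z y≁z hx
        ; leg-y = leg-cong t≢x t≢y x≁t y≁t hy
        ; two = trans (degree-cong z x≁z y≁z isRed) (Gadget.two h)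
        ; none = trans (degree-cong t x≁t y≁t isRed) (Gadget.none h)
        }
        where
        t = Gadget.tip h
        hx = Gadget.leg-x h
        hy = Gadget.leg-y h
        x≁z = proj₁ (not-nbrs (Leg.x-free hx) z≢x z≢y)
        y≁z = proj₂ (not-nbrs (Leg.x-free hx) z≢x z≢y)
        t≢x : t ≢ x
        t≢x refl = x≁z (Leg.x~y hy)
        t≢y : t ≢ y
        t≢y refl = y≁z (Leg.x~y hy)
        x≁t = proj₁ (not-nbrs (Leg.y-free hx) t≢x t≢y)
        y≁t = proj₂ (not-nbrs (Leg.y-free hx) t≢x t≢y)

      u-red : st′ u ≡ red
      u-red = trans (agree u (red≢free {st} stu x-free) (red≢free {st} stu y-free)) stu

      -- The tip has no red neighbour, so of the two decided vertices only `x` was adjacent to `u`.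
      u-nbr : ∀ z → freeNbr st′ u z ≡ (freeNbr st u without x) z
      u-nbr z with z Finₚ.≟ x
      ... | yes refl = trans (cong (λ s → does (u ~? z) ∧ isFree s) (proj₂ x-decided))
                         (trans (Boolₚ.∧-zeroʳ _) (sym (Boolₚ.∧-zeroʳ _)))
      ... | no z≢x with z Finₚ.≟ y
      ...   | yes refl = trans (cong (_∧ isFree (st′ z)) u≁y) (sym (cong (λ b → (b ∧ isFree (st z)) ∧ true) u≁y))
        where u≁y = dec-false (u ~? z) (λ u~y → y≁u (~-sym u~y))
      ...   | no z≢y = trans (cong (λ s → does (u ~? z) ∧ isFree s) (agree z z≢x z≢y)) (sym (Boolₚ.∧-identityʳ _))

      u-degree : freeDeg st′ u ≡ count (freeNbr st u without x)
      u-degree = sum-cong-≗ +-0-commutativeMonoid λ z → cong bit (u-nbr z)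

      u-gadgets : (∀ z → freeNbr st u z ≡ true → Gadget st z) → ∀ z → freeNbr st′ u z ≡ true → Gadget st′ z
      u-gadgets all z h with without-true⁻ (freeNbr st u) x (trans (sym (u-nbr z)) h)
      ... | uz , z≢x = gadget-cong z≢x z≢y (all z uz)
        where
        z≢y : z ≢ y
        z≢y refl = y≁u (~-sym (proj₁ (freeNbr⁻ {st} u z uz)))

  -- Branching on one gadget has the vector (50, 32, 32), which slightly exceeds 1.  But once all
  -- gadgets at a red vertex u are decided without X, u is forced into W; the first drop of 9 starts
  -- the recursion t(d + 1) = γ^-50 + 2 γ^-32 t(d), t(0) = γ^-9, listed below in thousandths for γ = p / q.
  GadgetClaim : ℕ → ℕ → Set
  GadgetClaim d c = ∀ {st u} → Inv st → IH st → st u ≡ red → freeDeg st u ≡ d →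
                    (∀ z → freeNbr st u z ≡ true → Gadget st z) → Good c st

  module _ {d c} (claim : GadgetClaim d c) {st u x} (inv : Inv st) (ih : IH st) (stu : st u ≡ red)
           (ux : freeNbr st u x ≡ true) (rest : count (freeNbr st u without x) ≡ d)
           (all : ∀ z → freeNbr st u z ≡ true → Gadget st z) where
    private
      g = all x ux
    open Gadget g renaming (tip to y)
    open Leg leg-x
    open GadgetStep inv stu ux g
    open IsolatedEdge leg-x leg-y inv

    -- Putting `x` into X sends `u` to N and ends the recursion, so that branch has the general
    -- constant 1000; in the other two `u` stays red with one gadget fewer.
    gadget-branches : List Branch
    gadget-branches = (setX x st , 1000 , 50) ∷ (setX y st , c , 32) ∷ (setW y (setW x st) , c , 32) ∷ []

    gadget-goods : All (λ (st′ , c′ , k) → Good c′ st′ × st′ ⊑[ k ] st) gadget-branches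
    gadget-goods =
      by-IH ih (inv-setX x-free inv) (setX-gain 1 2 x-free f≥1 (≤-reflexive (sym two))) ∷
      (good-for setX-removed (inv-setX y-free inv) gain₂ , gain₂) ∷
      (good-for setW-removed WW-inv WW-gain , WW-gain) ∷ []
      where
      gain₂ : setX y st ⊑[ 32 ] st
      gain₂ = setX-gain 1 0 y-free (Leg.f≥1 leg-y) z≤n
      good-for : ∀ {st′} → Removed st st′ x y → Inv st′ → st′ ⊑[ 32 ] st → Good c st′
      -- The weight has dropped, so the induction hypothesis at `st` contains the one that `claim`
      -- asks for at `st′`.
      good-for {st′} r inv′ gain = claim inv′
        (λ st″ inv″ lt → ih st″ inv″ (<-≤-trans lt (≤-trans (m≤m+n (μ st′) 32) gain)))
        (u-red r) (trans (u-degree r) rest) (u-gadgets r all)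

    gadget-covers : Covers st gadget-branches
    gadget-covers ℓ v c with edge-labels v c
    ... | inj₁ ℓx                 = here (compat-setX v c ℓx)
    ... | inj₂ (inj₁ ℓy)          = there (here (compat-setX v c ℓy))
    ... | inj₂ (inj₂ (ℓx , ℓy))   = there (there (here (setW² v c ℓx ℓy)))

  gadget-step : ∀ {d c c′} → GadgetClaim d c →
                Affordable c′ ((1000 , 50) ∷ (c , 32) ∷ (c , 32) ∷ []) → GadgetClaim (suc d) c′
  gadget-step {d} {c} claim cheap {st} {u} inv ih stu fu all with count>0 (freeNbr st u) fu
  ... | x , ux , rest = branch (gadget-branches claim inv ih stu ux rest all)
    (gadget-covers claim inv ih stu ux rest all) (gadget-goods claim inv ih stu ux rest all) cheap

  gadgets₀ : GadgetClaim 0 767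
  gadgets₀ inv ih stu f≡0 _ = rule-forced inv ih stu f≡0 (affordable tt)

  gadgets₁ : GadgetClaim 1 826
  gadgets₁ = gadget-step gadgets₀ (affordable tt)

  gadgets₂ : GadgetClaim 2 872
  gadgets₂ = gadget-step gadgets₁ (affordable tt)

  gadgets₃ : GadgetClaim 3 908
  gadgets₃ = gadget-step gadgets₂ (affordable tt)

  gadgets₄ : GadgetClaim 4 936
  gadgets₄ = gadget-step gadgets₃ (affordable tt)

  gadgets₅ : GadgetClaim 5 958
  gadgets₅ = gadget-step gadgets₄ (affordable tt)

  good-mono : ∀ {c c′ st} → c ≤ c′ → Good c st → Good c′ st
  good-mono {c} {c′} {st} c≤c′ g = good λ ls sols →
    bound-mono {c} {c′} {length ls} {μ st} c≤c′ (Good.bound g ls sols)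

  -- The recursion for the constants tends to about 1033, so it cannot serve all `d`; from six
  -- gadgets on `u` is a hub.
  all-gadgets : ∀ d → GadgetClaim d 1000
  all-gadgets 0 inv ih stu f all = good-mono (m≤m+n 767 _) (gadgets₀ inv ih stu f all)
  all-gadgets 1 inv ih stu f all = good-mono (m≤m+n 826 _) (gadgets₁ inv ih stu f all)
  all-gadgets 2 inv ih stu f all = good-mono (m≤m+n 872 _) (gadgets₂ inv ih stu f all)
  all-gadgets 3 inv ih stu f all = good-mono (m≤m+n 908 _) (gadgets₃ inv ih stu f all)
  all-gadgets 4 inv ih stu f all = good-mono (m≤m+n 936 _) (gadgets₄ inv ih stu f all)
  all-gadgets 5 inv ih stu f all = good-mono (m≤m+n 958 _) (gadgets₅ inv ih stu f all)
  all-gadgets (suc (suc (suc (suc (suc (suc d)))))) inv ih stu f all =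
    rule-hub inv ih stu (≤-trans (m≤m+n 6 d) (≤-reflexive (sym f)))

  -- Exhaustive case analysis of a state

  module Classify {st} (inv : Inv st) (ih : IH st) where

    back-leg : ∀ {x y} → Leg st x y → freeDeg st y ≡ 1 → Leg st y x
    back-leg {x} {y} l fy with leg (Leg.y-free l) fy
    ... | x′ , ly with Leg.only-y ly x (freeNbr⁺ {st} (~-sym (Leg.x~y l)) (Leg.x-free l))
    ...   | refl = ly

    y-degree : ∀ {x y} → Leg st x y → freeDeg st y ≢ 0
    y-degree {x} {y} l fy = count≡0 {b = freeNbr st y} fy x (freeNbr⁺ {st} (~-sym (Leg.x~y l)) (Leg.x-free l))

    classify-leg₁ : ∀ {x y} → Leg st x y → redDeg st x ≡ 1 → Good 1000 st
    classify-leg₁ {x} {y} l ax with freeDeg st y in fy | redDeg st y in ay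
    ... | 0 | _     = contradiction fy (y-degree l)
    ... | 1 | 0     = rule-tail l (back-leg l fy) inv ih ax ay
    ... | 1 | suc a = rule-edge l (back-leg l fy) inv ih (≤-reflexive (sym ax)) (subst (1 ≤_) (sym ay) (m≤m+n 1 a))
    ... | 2 | _     = rule-path l inv ih fy ax
    ... | suc (suc (suc f)) | _ = rule-leg l inv ih 64 41
      (setX-gain 3 0 y-free (subst (3 ≤_) (sym fy) (m≤m+n 3 f)) z≤n)
      (setX-gain 1 1 x-free f≥1 (≤-reflexive (sym ax))) (affordable tt)
      where open Leg l

    -- The one case that resists is an isolated edge whose far end has no red neighbour.
    classify-leg₂ : ∀ {x y} → Leg st x y → redDeg st x ≡ 2 → Gadget st x ⊎ Good 1000 st
    classify-leg₂ {x} {y} l ax with freeDeg st y in fy | redDeg st y in ay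
    ... | 0 | _     = contradiction fy (y-degree l)
    ... | 1 | 0     = inj₁ record { tip = y ; leg-x = l ; leg-y = back-leg l fy ; two = ax ; none = ay }
    ... | 1 | suc a = inj₂ (rule-edge l (back-leg l fy) inv ih (subst (1 ≤_) (sym ax) (m≤m+n 1 1)) (subst (1 ≤_) (sym ay) (m≤m+n 1 a)))
    ... | suc (suc f) | _ = inj₂ (rule-leg l inv ih 48 50
      (setX-gain 2 0 y-free (subst (2 ≤_) (sym fy) (m≤m+n 2 f)) z≤n)
      (setX-gain 1 2 x-free f≥1 (≤-reflexive (sym ax))) (affordable tt))
      where open Leg l

    classify : ∀ {u x} → st u ≡ red → x ~ u → st x ≡ free → Gadget st x ⊎ Good 1000 st
    classify {u} {x} stu x~u stx with freeDeg st x in fx | redDeg st x in ax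
    ... | _ | 0 = ⊥-elim (count≡0 {b = redNbr st x} ax u (redNbr⁺ {st} x~u stu))
    ... | 0 | 1 = inj₂ (rule-pendant inv ih stx fx ax)
    ... | 0 | suc (suc a) = inj₂ (rule-isolated inv ih stx fx (subst (2 ≤_) (sym ax) (m≤m+n 2 a)))
    ... | 1 | 1 = inj₂ (classify-leg₁ (proj₂ (leg stx fx)) ax)
    ... | 1 | 2 = classify-leg₂ (proj₂ (leg stx fx)) ax
    -- The drop is 16 + 16 + 3 · 9 = 59, two more than required.
    ... | 1 | suc (suc (suc a)) = inj₂ (rule-X? inv ih stx (⊑-weaken {setX x st} {st} (m≤m+n 57 2)
      (setX-gain 1 3 stx (≤-reflexive (sym fx)) (subst (3 ≤_) (sym ax) (m≤m+n 3 a)))))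
    ... | suc (suc f) | suc a = inj₂ (rule-X? inv ih stx
      (setX-gain 2 1 stx (subst (2 ≤_) (sym fx) (m≤m+n 2 f)) (subst (1 ≤_) (sym ax) (m≤m+n 1 a))))

    good-state : Good 1000 st
    good-state with Finₚ.any? (λ u → isRed (st u) Boolₚ.≟ true)
    ... | no none = leaf inv (λ z stz → none (z , cong isRed stz))
    ... | yes (u , ru) with ∀-⊎ classified
      where
      classified : ∀ x → (freeNbr st u x ≡ true → Gadget st x) ⊎ Good 1000 st
      classified x with freeNbr st u x in ux
      ... | false = inj₁ λ ()
      ... | true with classify (isRed⁻ ru) (~-sym (proj₁ (freeNbr⁻ {st} u x ux))) (proj₂ (freeNbr⁻ {st} u x ux))
      ...   | inj₁ g  = inj₁ λ _ → g
      ...   | inj₂ ok = inj₂ ok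
    ...   | inj₁ all  = all-gadgets (freeDeg st u) inv ih (isRed⁻ ru) refl all
    ...   | inj₂ ok   = ok

  good-all : ∀ st → Inv st → Good 1000 st
  good-all st inv = go st inv (<-wellFounded (μ st))
    where
    go : ∀ st → Inv st → Acc _<_ (μ st) → Good 1000 st
    go st inv (acc rec) = Classify.good-state inv (λ st′ inv′ lt → go st′ inv′ (rec lt))

  -- Guessing one vertex of W

  private
    free-state : State
    free-state _ = free

    from : Fin n → State
    from v = setW v free-state

    inv-from : ∀ v → Inv (from v)
    inv-from v .Inv.W≁free {a} {b} sa a~b sb
      with a ≟ᵇ v | does (v ~? a) | view v a | b ≟ᵇ v | does (v ~? b) | view v b | sa | sb
    ... | _ | _ | same refl | _ | _ | other _ v≁b | _  | _  = v≁b a~b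
    ... | _ | _ | nbr _ _   | _ | _ | other _ _   | () | _
    ... | _ | _ | other _ _ | _ | _ | other _ _   | () | _
    inv-from v .Inv.X~N {a} {b} sa a~b with a ≟ᵇ v | does (v ~? a) | view v a | sa
    ... | _ | _ | same refl | ()
    ... | _ | _ | nbr _ _   | ()
    ... | _ | _ | other _ _ | ()
    inv-from v .Inv.start = v , setW-self {free-state} v

    μ-from : ∀ v → μ (from v) ≤ 16 * n
    μ-from v = ≤-trans (m≤m+n (μ (from v)) _) (≤-trans (μ-setW {free-state} {v})
      (≤-reflexive (trans (∑-const n 16) (*-comm n 16))))

    starts : List (Fin n) → List Branch
    starts = List.map λ v → from v , 1000 , 0

  labelings-bound : ∀ {ls} → All Valid ls → All (λ ℓ → ∃ λ v → ℓ v ≡ inW) ls →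
                    AllPairs (λ ℓ ℓ′ → ¬ SameW ℓ ℓ′) ls → length ls * q ^ (16 * n) ≤ n * p ^ (16 * n)
  labelings-bound {ls} valid nonempty distinct = begin
    length ls * q ^ (16 * n)
      ≤⟨ *-monoˡ-≤ (q ^ (16 * n)) (length-covered (starts (List.allFin n)) (All.zipWith covered (valid , nonempty))) ⟩
    coverLength ls (starts (List.allFin n)) * q ^ (16 * n)
      ≤⟨ total (List.allFin n) ⟩
    length (List.allFin n) * p ^ (16 * n)
      ≡⟨ cong (_* p ^ (16 * n)) (Listₚ.length-tabulate {n = n} (λ i → i)) ⟩
    n * p ^ (16 * n) ∎
    where
    open ≤-Reasoning
    sols : Solutions free-state ls
    sols = valid , All.universal (λ _ _ → tt) ls , distinct
    covered : ∀ {ℓ} → Valid ℓ × (∃ λ v → ℓ v ≡ inW) → AnyBranch (starts (List.allFin n)) ℓ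
    covered (val , v , ℓv) = Anyₚ.map⁺ (Any.map (λ { refl → compat-setW {free-state} val (λ _ → tt) ℓv }) (∈-allFin v))
    from-start : ∀ v → length (filter (compat? (from v)) ls) * q ^ (16 * n) ≤ p ^ (16 * n)
    from-start v = bound-extend {l = length (filter (compat? (from v)) ls)} {m = μ (from v)} (Good.bound (good-all (from v) (inv-from v)) _ (solutions-filter (from v) sols)) (μ-from v)
    total : ∀ vs → coverLength ls (starts vs) * q ^ (16 * n) ≤ length vs * p ^ (16 * n)
    total []       = z≤n
    total (v ∷ vs) = ≤-trans
      (≤-reflexive (*-distribʳ-+ (q ^ (16 * n)) (length (filter (compat? (from v)) ls)) (coverLength ls (starts vs))))
      (+-mono-≤ (from-start v) (total vs))

  -- 1.6031 exceeds (p / q) ^ 16 by enough to absorb the factor n.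
  labelings-bound′ : ∀ {ls} → All Valid ls → All (λ ℓ → ∃ λ v → ℓ v ≡ inW) ls →
                     AllPairs (λ ℓ ℓ′ → ¬ SameW ℓ ℓ′) ls → length ls * 10000 ^ n ≤ 16031 ^ n * 16030
  labelings-bound′ {ls} valid nonempty distinct =
    absorb-linear-factor {q ^ 16} {p ^ 16} {10000} {16030} (≤ᵇ⇒≤ _ _ tt) n {length ls}
      (subst₂ (λ Q P → length ls * Q ≤ n * P) (sym (^-*-assoc q 16 n)) (sym (^-*-assoc p 16 n))
        (labelings-bound valid nonempty distinct))

-- K-sets and modular partitions

x∈p─q⇒x∉q : ∀ {n} {x : Fin n} (p q : Subset n) → x ∈ p ─ q → x ∉ q
x∈p─q⇒x∉q (a Vec.∷ p) (inside Vec.∷ q)  (Vec.there x∈) (Vec.there x∈q) = x∈p─q⇒x∉q p q x∈ x∈q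
x∈p─q⇒x∉q (a Vec.∷ p) (outside Vec.∷ q) (Vec.there x∈) (Vec.there x∈q) = x∈p─q⇒x∉q p q x∈ x∈q

∈-⋃-map⁻ : ∀ {n} {A : Set} (f : A → Subset n) as {x} → x ∈ ⋃ (List.map f as) → ∃ λ a → a ∈ˡ as × x ∈ f a
∈-⋃-map⁻ f []       x∈ = contradiction x∈ ∉⊥
∈-⋃-map⁻ f (a ∷ as) x∈ with x∈p∪q⁻ (f a) (⋃ (List.map f as)) x∈
... | inj₁ x∈fa = a , here refl , x∈fa
... | inj₂ x∈⋃ with ∈-⋃-map⁻ f as x∈⋃
...   | b , b∈ , x∈fb = b , there b∈ , x∈fb

∈-⋃-map⁺ : ∀ {n} {A : Set} (f : A → Subset n) {a} {as} {x} → a ∈ˡ as → x ∈ f a → x ∈ ⋃ (List.map f as)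
∈-⋃-map⁺ f (here refl) x∈fa = x∈p∪q⁺ (inj₁ x∈fa)
∈-⋃-map⁺ f (there a∈)  x∈fa = x∈p∪q⁺ (inj₂ (∈-⋃-map⁺ f a∈ x∈fa))

module Domination {n} (G : Graph n) where
  open Graph G

  ∈N⁺ : ∀ {v w} → v ~ w → w ∈ N v
  ∈N⁺ {v} {w} v~w = Vecₚ.lookup⇒[]= w (N v) (trans (Vecₚ.lookup∘tabulate _ w) (dec-true (v ~? w) v~w))

  ∈N⁻ : ∀ {v w} → w ∈ N v → v ~ w
  ∈N⁻ {v} {w} w∈ with v ~? w | trans (sym (Vecₚ.lookup∘tabulate (λ w → does (v ~? w)) w)) (Vecₚ.[]=⇒lookup w∈)
  ... | yes v~w | _ = v~w

  Dominated : Subset n → Fin n → Set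
  Dominated X v = ∃ λ x → x ∈ X × (v ≡ x ⊎ x ~ v)

  ∈N[]⁻ : ∀ {X v} → v ∈ N[ X ]ˢ → Dominated X v
  ∈N[]⁻ {X} {v} v∈ with ∈-⋃-map⁻ N[_] (filter (_∈? X) (List.allFin n)) v∈
  ... | x , x∈ , v∈N[x] with x∈p∪q⁻ (N x) _ v∈N[x]
  ...   | inj₁ v∈N = x , proj₂ (∈-filter⁻ (_∈? X) {xs = List.allFin n} x∈) , inj₂ (∈N⁻ v∈N)
  ...   | inj₂ v∈x = x , proj₂ (∈-filter⁻ (_∈? X) {xs = List.allFin n} x∈) , inj₁ (x∈⁅y⁆⇒x≡y x v∈x)

  ∈N[]⁺ : ∀ {X v} → Dominated X v → v ∈ N[ X ]ˢ
  ∈N[]⁺ {X} {v} (x , x∈X , eq-or-adj) =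
    ∈-⋃-map⁺ N[_] (∈-filter⁺ (_∈? X) (∈-allFin x) x∈X) (x∈p∪q⁺ (near eq-or-adj))
    where
    near : v ≡ x ⊎ x ~ v → _
    near (inj₁ refl) = inj₂ (x∈⁅x⁆ x)
    near (inj₂ x~v)  = inj₁ (∈N⁺ x~v)

  undominated⁻ : ∀ {W X v} → W ≡ V ─ N[ X ]ˢ → v ∈ W → v ∈ V × ¬ Dominated X v
  undominated⁻ {X = X} refl v∈ = p─q⊆p V N[ X ]ˢ v∈ , λ d → x∈p─q⇒x∉q V N[ X ]ˢ v∈ (∈N[]⁺ d)

  undominated⁺ : ∀ {W X v} → W ≡ V ─ N[ X ]ˢ → v ∈ V → ¬ Dominated X v → v ∈ W
  undominated⁺ refl v∈V ¬d = x∈p∧x∉q⇒x∈p─q v∈V (¬d ∘ ∈N[]⁻)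

labelOf : ∀ {A B : Set} → Dec A → Dec B → Label
labelOf (yes _) _       = inW
labelOf (no _)  (yes _) = inX
labelOf (no _)  (no _)  = inN

-- The quotient graph of a modular partition

module Quotient {n k} (G : Graph n) (P : Fin k → Subset n) (part : IsModularPartition G P) where
  open Graph G
  open IsModularPartition part
  open Domination G

  _⇄_ : Fin k → Fin k → Set
  i ⇄ j = i ≢ j × ∃₂ λ a b → a ∈ P i × b ∈ P j × a ~ b

  _⇄?_ : ∀ i j → Dec (i ⇄ j)
  i ⇄? j = ¬? (i Finₚ.≟ j) ×-dec Finₚ.any? λ a → Finₚ.any? λ b → (a ∈? P i) ×-dec (b ∈? P j) ×-dec (a ~? b)

  ⇄-sym : ∀ {i j} → i ⇄ j → j ⇄ i
  ⇄-sym (i≢j , a , b , a∈ , b∈ , a~b) = i≢j ∘ sym , b , a , b∈ , a∈ , ~-sym a~b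

  ⇄-irrefl : ∀ {i} → ¬ i ⇄ i
  ⇄-irrefl (i≢i , _) = i≢i refl

  open Counting _⇄_ _⇄?_ ⇄-sym ⇄-irrefl

  P⊆V : ∀ i → P i ⊆ V
  P⊆V i = proj₁ (modules i)

  same-part : ∀ {v i j} → v ∈ P i → v ∈ P j → i ≡ j
  same-part {v} {i} {j} v∈i v∈j with i Finₚ.≟ j
  ... | yes i≡j = i≡j
  ... | no i≢j  = contradiction (v , x∈p∩q⁺ (v∈i , v∈j)) (disjoint i j i≢j)

  outside-adjacent : ∀ {v a b i} → v ∉ P i → v ~ a → a ∈ P i → b ∈ P i → v ~ b
  outside-adjacent {v} {a} {b} {i} v∉ v~a a∈ b∈ with proj₂ (modules i) v (~-source v~a) v∉
  ... | inj₁ empty = contradiction (a , x∈p∩q⁺ (a∈ , ∈N⁺ v~a)) empty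
  ... | inj₂ all   = ∈N⁻ (all b∈)

  -- The module property is used twice: `b₀`, outside `P i`, sees `a` because it sees `a₀`; then
  -- `a`, outside `P j`, sees `b` because it sees `b₀`.
  parts-adjacent : ∀ {i j a b} → i ⇄ j → a ∈ P i → b ∈ P j → a ~ b
  parts-adjacent {i} {j} (i≢j , a₀ , b₀ , a₀∈ , b₀∈ , a₀~b₀) a∈ b∈ =
    outside-adjacent (λ a∈j → i≢j (same-part a∈ a∈j))
      (~-sym (outside-adjacent (λ b₀∈i → i≢j (same-part b₀∈i b₀∈)) (~-sym a₀~b₀) a₀∈ a∈)) b₀∈ b∈

  Spread : Subset n → Set
  Spread W = IsKSet G W × ¬ ∃ λ i → W ⊆ P i

  spread? : ∀ W → Dec (Spread W)
  spread? W = isKSet? G W ×-dec ¬? (Finₚ.any? λ i → W ⊆? P i)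

  -- `X ∩ P i` dominates the same vertices of the part as `X`: a vertex of `X` outside the part that
  -- sees one of its vertices would see all of it, including `w` in `W`.
  kSet-in-part : ∀ {W i} → IsKSet G W → W ⊆ P i → IsKSet (G [ P i ]) W
  kSet-in-part {W} {i} (W⊆V , (w , w∈W) , conn , X , X⊆V , indep , W≡) W⊆P =
    (λ v∈ → x∈p∩q⁺ (W⊆V v∈ , W⊆P v∈)) , (w , w∈W) , conn′ , X ∩ P i ,
    (λ v∈ → let (v∈X , v∈P) = x∈p∩q⁻ X (P i) v∈ in x∈p∩q⁺ (X⊆V v∈X , v∈P)) ,
    (λ a b a∈ b∈ (a~b , _) → indep a b (proj₁ (x∈p∩q⁻ X (P i) a∈)) (proj₁ (x∈p∩q⁻ X (P i) b∈)) a~b) ,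
    ⊆-antisym to from
    where
    module Part = Domination (G [ P i ])
    conn′ : Graph.Connected (G [ P i ] [ W ])
    conn′ a b a∈ b∈ = Star.map (λ (a~b , a∈W , b∈W) → (a~b , W⊆P a∈W , W⊆P b∈W) , a∈W , b∈W)
      (conn a b (in-W a∈) (in-W b∈))
      where
      in-W : ∀ {a} → a ∈ (V ∩ P i) ∩ W → a ∈ V ∩ W
      in-W a∈ = let a∈W = proj₂ (x∈p∩q⁻ (V ∩ P i) W a∈) in x∈p∩q⁺ (W⊆V a∈W , a∈W)
    dominated : ∀ {v} → v ∈ P i → Dominated X v → Part.Dominated (X ∩ P i) v
    dominated {v} v∈P (x , x∈X , inj₁ refl) = x , x∈p∩q⁺ (x∈X , v∈P) , inj₁ refl
    dominated {v} v∈P (x , x∈X , inj₂ x~v) with x ∈? P i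
    ... | yes x∈P = x , x∈p∩q⁺ (x∈X , x∈P) , inj₂ (x~v , x∈P , v∈P)
    ... | no x∉P  = contradiction (x , x∈X , inj₂ (outside-adjacent x∉P x~v v∈P (W⊆P w∈W)))
                      (proj₂ (undominated⁻ W≡ w∈W))
    dominated⁻ : ∀ {v} → Part.Dominated (X ∩ P i) v → Dominated X v
    dominated⁻ (x , x∈ , inj₁ v≡x)       = x , proj₁ (x∈p∩q⁻ X (P i) x∈) , inj₁ v≡x
    dominated⁻ (x , x∈ , inj₂ (x~v , _)) = x , proj₁ (x∈p∩q⁻ X (P i) x∈) , inj₂ x~v
    to : W ⊆ _
    to v∈ = Part.undominated⁺ refl (x∈p∩q⁺ (W⊆V v∈ , W⊆P v∈))
      (proj₂ (undominated⁻ W≡ v∈) ∘ dominated⁻)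
    from : _ ⊆ W
    from v∈ with Part.undominated⁻ {X = X ∩ P i} refl v∈
    ... | v∈VP , ¬d with x∈p∩q⁻ V (P i) v∈VP
    ...   | v∈V , v∈P = undominated⁺ W≡ v∈V (¬d ∘ dominated v∈P)

  module _ {W X : Subset n} (conn : Graph.Connected (G [ W ])) (W⊆V : W ⊆ V) (X⊆V : X ⊆ V)
           (indep : Independent X) (W≡ : W ≡ V ─ N[ X ]ˢ) (spread : ¬ ∃ λ i → W ⊆ P i) where

    private
      Step : Fin n → Fin n → Set
      Step a b = a ~ b × a ∈ W × b ∈ W

      path : ∀ {a b} → a ∈ W → b ∈ W → Star Step a b
      path a∈ b∈ = conn _ _ (x∈p∩q⁺ (W⊆V a∈ , a∈)) (x∈p∩q⁺ (W⊆V b∈ , b∈))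

      undominated : ∀ {v} → v ∈ W → ¬ Dominated X v
      undominated = proj₂ ∘ undominated⁻ W≡

      leaves : ∀ i → ∃ λ w → w ∈ W × w ∉ P i
      leaves i with Finₚ.any? (λ w → (w ∈? W) ×-dec ¬? (w ∈? P i))
      ... | yes found = found
      ... | no none   = contradiction (i , λ {w} w∈ → decidable-stable (w ∈? P i) (λ w∉ → none (w , w∈ , w∉))) spread

      exit : ∀ {w i} → w ∈ W → w ∈ P i → ∃₂ λ a b → a ∈ W × a ∈ P i × b ∈ W × b ∉ P i × a ~ b
      exit {w} {i} w∈W w∈P with leaves i
      ... | w′ , w′∈W , w′∉P = walk w∈P (path w∈W w′∈W)
        where
        walk : ∀ {c} → c ∈ P i → Star Step c w′ → ∃₂ λ a b → a ∈ W × a ∈ P i × b ∈ W × b ∉ P i × a ~ b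
        walk c∈P Star.ε = contradiction c∈P w′∉P
        walk c∈P (_◅_ {j = d} (c~d , c∈W , d∈W) rest) with d ∈? P i
        ... | yes d∈P = walk d∈P rest
        ... | no d∉P  = _ , d , c∈W , c∈P , d∈W , d∉P , c~d

      -- `W` leaves the part by an edge to some `b` in `W` outside it. As the part is a module, `b`
      -- sees all of it, but no vertex of `W` sees `X`.
      X-avoids : ∀ {w x i} → w ∈ W → w ∈ P i → x ∈ X → x ∉ P i
      X-avoids w∈W w∈P x∈X x∈P with exit w∈W w∈P
      ... | a , b , a∈W , a∈P , b∈W , b∉P , a~b =
        undominated b∈W (_ , x∈X , inj₂ (~-sym (outside-adjacent b∉P (~-sym a~b) a∈P x∈P)))

      -- By `X-avoids` any dominator lies outside the part, and from there it would dominate `w`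
      -- too.
      W-whole : ∀ {w v i} → w ∈ W → w ∈ P i → v ∈ P i → v ∈ W
      W-whole {w} {v} {i} w∈W w∈P v∈P = undominated⁺ W≡ (P⊆V i v∈P) not-dominated
        where
        not-dominated : ¬ Dominated X v
        not-dominated (x , x∈X , inj₁ refl) = X-avoids w∈W w∈P x∈X v∈P
        not-dominated (x , x∈X , inj₂ x~v)  =
          undominated w∈W (x , x∈X , inj₂ (outside-adjacent (X-avoids w∈W w∈P x∈X) x~v v∈P w∈P))

    labeling : Labeling
    labeling i = labelOf (nonempty? (W ∩ P i)) (nonempty? (X ∩ P i))

    labeling-W⁻ : ∀ {i} → labeling i ≡ inW → ∃ λ w → w ∈ W × w ∈ P i
    labeling-W⁻ {i} eq with nonempty? (W ∩ P i) | nonempty? (X ∩ P i)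
    ... | yes (w , w∈) | _ = w , x∈p∩q⁻ W (P i) w∈
    labeling-W⁻ {i} () | no _ | yes _
    labeling-W⁻ {i} () | no _ | no _

    labeling-W⁺ : ∀ {i w} → w ∈ W → w ∈ P i → labeling i ≡ inW
    labeling-W⁺ {i} w∈W w∈P with nonempty? (W ∩ P i)
    ... | yes _ = refl
    ... | no empty = contradiction (_ , x∈p∩q⁺ (w∈W , w∈P)) empty

    private
      labeling-X⁻ : ∀ {i} → labeling i ≡ inX → ∃ λ x → x ∈ X × x ∈ P i
      labeling-X⁻ {i} eq with nonempty? (W ∩ P i) | nonempty? (X ∩ P i)
      labeling-X⁻ {i} () | yes _ | _
      ... | no _ | yes (x , x∈) = x , x∈p∩q⁻ X (P i) x∈
      labeling-X⁻ {i} () | no _ | no _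

      labeling-X⁺ : ∀ {i x} → x ∈ X → x ∈ P i → labeling i ≡ inX
      labeling-X⁺ {i} x∈X x∈P with nonempty? (W ∩ P i) | nonempty? (X ∩ P i)
      ... | yes (w , w∈) | _ with x∈p∩q⁻ W (P i) w∈
      ...   | w∈W , w∈P = contradiction x∈P (X-avoids w∈W w∈P x∈X)
      labeling-X⁺ {i} x∈X x∈P | no _ | yes _    = refl
      labeling-X⁺ {i} x∈X x∈P | no _ | no empty = contradiction (_ , x∈p∩q⁺ (x∈X , x∈P)) empty

      labeling-N⁻ : ∀ {i v} → labeling i ≡ inN → v ∈ P i → v ∉ W × v ∉ X
      labeling-N⁻ eq v∈P =
        (λ v∈W → case trans (sym eq) (labeling-W⁺ v∈W v∈P) of λ ()) ,
        (λ v∈X → case trans (sym eq) (labeling-X⁺ v∈X v∈P) of λ ())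

    labeling-W-whole : ∀ {i v} → labeling i ≡ inW → v ∈ P i → v ∈ W
    labeling-W-whole eq v∈P with labeling-W⁻ eq
    ... | w , w∈W , w∈P = W-whole w∈W w∈P v∈P

    labeling-valid : Valid labeling
    labeling-valid .Valid.W≁X ℓi ℓj i⇄j with labeling-W⁻ ℓi | labeling-X⁻ ℓj
    ... | w , w∈W , w∈P | x , x∈X , x∈P =
      undominated w∈W (x , x∈X , inj₂ (~-sym (parts-adjacent i⇄j w∈P x∈P)))
    labeling-valid .Valid.X≁X ℓi ℓj i⇄j with labeling-X⁻ ℓi | labeling-X⁻ ℓj
    ... | x , x∈X , x∈P | y , y∈X , y∈P = indep x y x∈X y∈X (parts-adjacent i⇄j x∈P y∈P)
    labeling-valid .Valid.N~X {i} ℓi with nonempty i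
    -- One vertex of the part suffices: it is neither in `W` nor in `X`, so it is dominated along an
    -- edge, and that edge leaves the part because the part contains no vertex of `X`.
    ... | v , v∈P with labeling-N⁻ ℓi v∈P
    ...   | v∉W , v∉X with v ∈? N[ X ]ˢ
    ...     | no v∉N = contradiction (undominated⁺ W≡ (P⊆V i v∈P) (v∉N ∘ ∈N[]⁺)) v∉W
    ...     | yes v∈N with ∈N[]⁻ v∈N
    ...       | x , x∈X , inj₁ refl = contradiction x∈X v∉X
    ...       | x , x∈X , inj₂ x~v with covers x (X⊆V x∈X)
    ...         | j , x∈P = j , (i≢j , v , x , v∈P , x∈P , ~-sym x~v) , labeling-X⁺ x∈X x∈P
      where
      i≢j : i ≢ j
      i≢j refl = proj₂ (labeling-N⁻ ℓi x∈P) x∈X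
    labeling-valid .Valid.connected {i} {j} ℓi ℓj with labeling-W⁻ ℓi | labeling-W⁻ ℓj
    ... | a , a∈W , a∈P | b , b∈W , b∈P = project a∈P (path a∈W b∈W)
      where
      project : ∀ {a i} → a ∈ P i → Star Step a b →
                Star (λ i j → i ⇄ j × labeling i ≡ inW × labeling j ≡ inW) i j
      project a∈P Star.ε with same-part a∈P b∈P
      ... | refl = Star.ε
      project {i = i} a∈P ((_◅_ {j = c} (a~c , a∈W , c∈W) rest)) with covers c (W⊆V c∈W)
      ... | i′ , c∈P with i Finₚ.≟ i′
      -- Edges inside a part disappear from the projected path.
      ...   | yes refl = project c∈P rest
      ...   | no i≢i′  = ((i≢i′ , _ , c , a∈P , c∈P , a~c) , labeling-W⁺ a∈W a∈P , labeling-W⁺ c∈W c∈P) ◅ project c∈P rest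

  labelingOf : ∃ Spread → Labeling
  labelingOf (W , (W⊆V , _ , conn , X , X⊆V , indep , W≡) , spread) = labeling conn W⊆V X⊆V indep W≡ spread

  labelingOf-valid : ∀ W → Valid (labelingOf W)
  labelingOf-valid (W , (W⊆V , _ , conn , X , X⊆V , indep , W≡) , spread) = labeling-valid conn W⊆V X⊆V indep W≡ spread

  labelingOf-nonempty : ∀ W → ∃ λ i → labelingOf W i ≡ inW
  labelingOf-nonempty (W , (W⊆V , (w , w∈W) , conn , X , X⊆V , indep , W≡) , spread) with covers w (W⊆V w∈W)
  ... | i , w∈P = i , labeling-W⁺ conn W⊆V X⊆V indep W≡ spread w∈W w∈P

  ⊆-by-labels : ∀ W W′ → (∀ i → labelingOf W i ≡ inW → labelingOf W′ i ≡ inW) → proj₁ W ⊆ proj₁ W′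
  ⊆-by-labels (W , (W⊆V , _ , conn , X , X⊆V , indep , W≡) , spread)
              (W′ , (W′⊆V , _ , conn′ , X′ , X′⊆V , indep′ , W′≡) , spread′) h {v} v∈W with covers v (W⊆V v∈W)
  ... | i , v∈P = labeling-W-whole conn′ W′⊆V X′⊆V indep′ W′≡ spread′
                    (h i (labeling-W⁺ conn W⊆V X⊆V indep W≡ spread v∈W v∈P)) v∈P

  -- A spread K-set is a union of parts, so the parts labeled W determine it, whichever `X` was
  -- chosen.
  labelingOf-injective : ∀ W W′ → SameW (labelingOf W) (labelingOf W′) → proj₁ W ≡ proj₁ W′
  labelingOf-injective W W′ eqW =
    ⊆-antisym (⊆-by-labels W W′ (proj₁ ∘ eqW)) (⊆-by-labels W′ W (proj₂ ∘ eqW))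

-- Counting in filtered lists

module _ {A : Set} where

  length-filter-⊆ : ∀ {P Q : A → Set} (P? : ∀ x → Dec (P x)) (Q? : ∀ x → Dec (Q x)) xs →
                    (∀ x → P x → Q x) → length (filter P? xs) ≤ length (filter Q? xs)
  length-filter-⊆ P? Q? xs P⊆Q = ≤-trans
    (length-filters P? Q? (λ _ → no λ (e : ⊥) → e) xs (All.universal (λ x px → inj₁ (P⊆Q x px)) xs))
    (≤-reflexive (trans (cong (λ ys → length (filter Q? xs) + length ys) (Listₚ.filter-none _ (All.universal (λ _ e → e) xs)))
      (+-identityʳ _)))

  length-filter-∑ : ∀ {k} {P R : A → Set} {Q : Fin k → A → Set}
                    (P? : ∀ x → Dec (P x)) (Q? : ∀ i x → Dec (Q i x)) (R? : ∀ x → Dec (R x)) xs →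
                    (∀ x → P x → (∃ λ i → Q i x) ⊎ R x) →
                    length (filter P? xs) ≤ ∑ (λ i → length (filter (Q? i) xs)) + length (filter R? xs)
  length-filter-∑ {zero} P? Q? R? xs cases = length-filter-⊆ P? R? xs λ x px → case cases x px of λ where
    (inj₂ r) → r
  length-filter-∑ {suc k} {P} {R} {Q} P? Q? R? xs cases = begin
    length (filter P? xs)
      ≤⟨ length-filters P? (Q? zero) S? xs (All.universal first xs) ⟩
    length (filter (Q? zero) xs) + length (filter S? xs)
      ≤⟨ +-monoʳ-≤ (length (filter (Q? zero) xs)) (length-filter-∑ S? (Q? ∘ suc) R? xs λ _ s → s) ⟩
    length (filter (Q? zero) xs) + (∑ (λ i → length (filter (Q? (suc i)) xs)) + length (filter R? xs))
      ≡⟨ +-assoc (length (filter (Q? zero) xs)) _ _ ⟨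
    ∑ (λ i → length (filter (Q? i) xs)) + length (filter R? xs) ∎
    where
    open ≤-Reasoning
    S : A → Set
    S x = (∃ λ i → Q (suc i) x) ⊎ R x
    S? : ∀ x → Dec (S x)
    S? x = Finₚ.any? (λ i → Q? (suc i) x) ⊎-dec R? x
    first : ∀ x → P x → Q zero x ⊎ S x
    first x px with cases x px
    ... | inj₁ (zero , q)  = inj₁ q
    ... | inj₁ (suc i , q) = inj₂ (inj₁ (i , q))
    ... | inj₂ r           = inj₂ (inj₂ r)

  -- Keeps next to each set the witness `X` from which its labeling is built.
  withProofs : ∀ {P : A → Set} {xs} → All P xs → List (∃ P)
  withProofs = All.reduce (λ {x} px → x , px)

  map-proj₁-withProofs : ∀ {P : A → Set} {xs} (pxs : All P xs) → List.map proj₁ (withProofs pxs) ≡ xs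
  map-proj₁-withProofs []         = refl
  map-proj₁-withProofs (_ ∷ pxs) = cong (_ ∷_) (map-proj₁-withProofs pxs)

  unique-constant : ∀ {xs : List A} {a} → AllPairs _≢_ xs → All (_≡ a) xs → length xs ≤ 1
  unique-constant []      _ = z≤n
  unique-constant (_ ∷ []) _ = s≤s z≤n
  unique-constant ((x≢y ∷ _) ∷ _ ∷ _) (refl ∷ refl ∷ _) = contradiction refl x≢y

allSubsets-unique : ∀ n → AllPairs _≢_ (allSubsets n)
allSubsets-unique zero    = [] ∷ []
allSubsets-unique (suc n) = Uniqueₚ.++⁺
  (Uniqueₚ.map⁺ Vecₚ.∷-injectiveʳ (allSubsets-unique n))
  (Uniqueₚ.map⁺ Vecₚ.∷-injectiveʳ (allSubsets-unique n))
  disjoint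
  where
  disjoint : ∀ {v} → ¬ (v ∈ˡ List.map (inside Vec.∷_) (allSubsets n) × v ∈ˡ List.map (outside Vec.∷_) (allSubsets n))
  disjoint (v∈ , v∈′) with ∈-map⁻ (inside Vec.∷_) v∈ | ∈-map⁻ (outside Vec.∷_) v∈′
  ... | _ , _ , refl | _ , _ , ()

size : ∀ {n} (p : Subset n) → ∣ p ∣ ≡ count (Vec.lookup p)
size Vec.[]            = refl
size (inside Vec.∷ p)  = cong suc (size p)
size (outside Vec.∷ p) = size p

count≤1 : ∀ {n} (b : Fin n → Bool) → (∀ i j → b i ≡ true → b j ≡ true → i ≡ j) → count b ≤ 1
count≤1 b unique with count b in eq
... | 0 = z≤n
... | 1 = s≤s z≤n
... | suc (suc m) with count>0 b eq
...   | i , bi , rest with count>0 (b without i) rest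
...     | j , bj , _ with without-true⁻ b i bj
...       | bj′ , j≢i = contradiction (unique j i bj′ bi) j≢i

-- K-sets at one node of the decomposition tree

module KappaBound {n k} (G : Graph n) (P : Fin k → Subset n) (part : IsModularPartition G P) where
  open Graph G using (V)
  open Quotient G P part
  open Counting _⇄_ _⇄?_ ⇄-sym ⇄-irrefl using (labelings-bound′)
  open IsModularPartition part

  spreadSets : List (Subset n)
  spreadSets = filter spread? (allSubsets n)

  κ-split : κ G ≤ ∑ (λ i → κ (G [ P i ])) + length spreadSets
  κ-split = length-filter-∑ (isKSet? G) (λ i → isKSet? (G [ P i ])) spread? (allSubsets n) within-or-spread
    where
    within-or-spread : ∀ W → IsKSet G W → (∃ λ i → IsKSet (G [ P i ]) W) ⊎ Spread W
    within-or-spread W kset with Finₚ.any? (λ i → W ⊆? P i)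
    ... | yes (i , W⊆P) = inj₁ (i , kSet-in-part kset W⊆P)
    ... | no none       = inj₂ (kset , none)

  spread-bound : length spreadSets * 10000 ^ k ≤ 16031 ^ k * 16030
  spread-bound = subst (λ l → l * 10000 ^ k ≤ 16031 ^ k * 16030) same-length
    (labelings-bound′ (Allₚ.map⁺ (All.universal labelingOf-valid sets))
      (Allₚ.map⁺ (All.universal labelingOf-nonempty sets))
      (AllPairsₚ.map⁺ (AllPairs.map (λ {W} {W′} W≢W′ same → W≢W′ (labelingOf-injective W W′ same)) distinct)))
    where
    all-spread : All Spread spreadSets
    all-spread = Allₚ.all-filter spread? (allSubsets n)
    sets : List (∃ Spread)
    sets = withProofs all-spread
    same-length : length (List.map labelingOf sets) ≡ length spreadSets
    same-length = trans (Listₚ.length-map labelingOf sets) (trans (sym (Listₚ.length-map proj₁ sets))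
      (cong length (map-proj₁-withProofs all-spread)))
    distinct : AllPairs (λ W W′ → proj₁ W ≢ proj₁ W′) sets
    distinct = AllPairsₚ.map⁻ (subst (AllPairs _≢_) (sym (map-proj₁-withProofs all-spread))
      (AllPairsₚ.filter⁺ spread? (allSubsets-unique n)))

  -- Double counting of pairs of a part and a vertex in it: parts are disjoint, so each vertex is
  -- counted at most once.
  ∑-sizes : ∑ (λ i → ∣ V ∩ P i ∣) ≤ ∣ V ∣
  ∑-sizes = begin
    ∑ (λ i → ∣ V ∩ P i ∣)        ≡⟨ sum-cong-≗ +-0-commutativeMonoid (λ i → size (V ∩ P i)) ⟩
    ∑ (λ i → ∑ (bit ∘ in-part i)) ≡⟨ ∑-comm +-0-commutativeMonoid (λ i v → bit (in-part i v)) ⟩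
    ∑ (λ v → count (λ i → in-part i v)) ≤⟨ ∑-mono-≤ at-most-once ⟩
    count (Vec.lookup V)          ≡⟨ size V ⟨
    ∣ V ∣                         ∎
    where
    open ≤-Reasoning
    in-part : Fin k → Fin n → Bool
    in-part i = Vec.lookup (V ∩ P i)
    member : ∀ {i v} → in-part i v ≡ true → v ∈ V × v ∈ P i
    member {i} {v} eq = x∈p∩q⁻ V (P i) (Vecₚ.lookup⇒[]= v (V ∩ P i) eq)
    at-most-once : ∀ v → count (λ i → in-part i v) ≤ bit (Vec.lookup V v)
    at-most-once v with Vec.lookup V v in v∈V?
    ... | true = count≤1 (λ i → in-part i v) λ i j pi pj → same-part (proj₂ (member {i} pi)) (proj₂ (member {j} pj))
    ... | false with count (λ i → in-part i v) in eq
    ...   | 0 = z≤n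
    ...   | suc m with count>0 (λ i → in-part i v) eq
    ...     | i , pi , _ = case trans (sym v∈V?) (Vecₚ.[]=⇒lookup (proj₁ (member {i} pi))) of λ ()

κ-single : ∀ {n} (G : Graph n) → ∣ Graph.V G ∣ ≡ 1 → κ G ≤ 1
κ-single {n} G size≡1 = unique-constant (AllPairsₚ.filter⁺ (isKSet? G) (allSubsets-unique n))
  (All.map whole (Allₚ.all-filter (isKSet? G) (allSubsets n)))
  where
  open Graph G using (V)
  whole : ∀ {W} → IsKSet G W → W ≡ V
  whole {W} (W⊆V , (w , w∈W) , _) = ⊆-antisym W⊆V λ {v} v∈V → decidable-stable (v ∈? W) λ v∉W →
    <-irrefl refl (≤-trans (s≤s (≤-trans (s≤s z≤n) (x∈p⇒∣p-x∣<∣p∣ w∈W)))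
      (subst (suc ∣ W ∣ ≤_) size≡1 (p⊂q⇒∣p∣<∣q∣ (W⊆V , v , v∈V , v∉W))))

-- Summation over the decomposition tree

scale-power : ∀ {l a b c} k k′ → b ≤ a → k′ ≤ k → l * b ^ k′ ≤ a ^ k′ * c → l * b ^ k ≤ a ^ k * c
scale-power {l} {a} {b} {c} k k′ b≤a k′≤k le = begin
  l * b ^ k              ≡⟨ cong (l *_) (power b) ⟩
  l * (b ^ k′ * b ^ j)   ≡⟨ *-assoc l (b ^ k′) (b ^ j) ⟨
  l * b ^ k′ * b ^ j     ≤⟨ *-mono-≤ le (^-monoˡ-≤ j b≤a) ⟩
  a ^ k′ * c * a ^ j     ≡⟨ lemma (a ^ k′) c (a ^ j) ⟩
  a ^ k′ * a ^ j * c     ≡⟨ cong (_* c) (power a) ⟨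
  a ^ k * c              ∎
  where
  open ≤-Reasoning
  j = k ∸ k′
  power : ∀ x → x ^ k ≡ x ^ k′ * x ^ j
  power x = trans (cong (x ^_) (sym (m+[n∸m]≡n k′≤k))) (^-distribˡ-+-* x k′ j)
  lemma : ∀ x y z → x * y * z ≡ x * z * y
  lemma = solve-∀

-- The hypothesis on a part reads `κs i * D ≤ (2 sizes i - 1) * F`. The node itself adds at most
-- `F`; the `k′ ≥ 2` summands `- F` pay for it and leave one over for the conclusion.
sum-parts : ∀ {k′} (κs sizes : Fin k′ → ℕ) {K L D F s} → 2 ≤ k′ → K ≤ ∑ κs + L → L * D ≤ F →
            (∀ i → κs i * D + F ≤ sizes i * (2 * F)) → ∑ sizes ≤ s → K * D + F ≤ s * (2 * F)
sum-parts {k′} κs sizes {K} {L} {D} {F} {s} 2≤k′ K≤ LD≤F parts sizes≤ = begin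
  K * D + F                          ≤⟨ +-monoˡ-≤ F (*-monoˡ-≤ D K≤) ⟩
  (∑ κs + L) * D + F                 ≡⟨ cong (_+ F) (*-distribʳ-+ D (∑ κs) L) ⟩
  ∑ κs * D + L * D + F               ≤⟨ +-monoˡ-≤ F (+-monoʳ-≤ (∑ κs * D) LD≤F) ⟩
  ∑ κs * D + F + F                   ≡⟨ lemma (∑ κs * D) F ⟩
  ∑ κs * D + 2 * F                   ≤⟨ +-monoʳ-≤ (∑ κs * D) (*-monoˡ-≤ F 2≤k′) ⟩
  ∑ κs * D + k′ * F                  ≡⟨ cong₂ _+_ (trans (*-comm (∑ κs) D) (sym (∑-*ˡ D κs))) (sym (∑-const k′ F)) ⟩
  ∑ (λ i → D * κs i) + ∑ {k′} (λ _ → F)  ≡⟨ ∑-+ (λ i → D * κs i) (λ _ → F) ⟨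
  ∑ (λ i → D * κs i + F)             ≤⟨ ∑-mono-≤ (λ i → ≤-trans (≤-reflexive (cong (_+ F) (*-comm D (κs i))))
                                          (≤-trans (parts i) (≤-reflexive (*-comm (sizes i) (2 * F))))) ⟩
  ∑ (λ i → 2 * F * sizes i)          ≡⟨ ∑-*ˡ (2 * F) sizes ⟩
  2 * F * ∑ sizes                    ≤⟨ *-monoʳ-≤ (2 * F) sizes≤ ⟩
  2 * F * s                          ≡⟨ *-comm (2 * F) s ⟩
  s * (2 * F)                        ∎
  where
  open ≤-Reasoning
  lemma : ∀ a b → a + b + b ≡ a + 2 * b
  lemma = solve-∀

-- The summand 16031 ^ k * 16030 on the left makes the induction over the partition close.
κ-bound : ∀ {n} {G : Graph n} {k} → MW≤ G k →
          κ G * 10000 ^ k + 16031 ^ k * 16030 ≤ ∣ Graph.V G ∣ * (2 * (16031 ^ k * 16030))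
κ-bound {G = G} {k} (single _ size≡1) = begin
  κ G * 10000 ^ k + F      ≤⟨ +-monoˡ-≤ F (≤-trans (*-monoˡ-≤ (10000 ^ k) (κ-single G size≡1)) one) ⟩
  F + F                    ≡⟨ lemma F ⟩
  1 * (2 * F)              ≡⟨ cong (_* (2 * F)) size≡1 ⟨
  ∣ Graph.V G ∣ * (2 * F)  ∎
  where
  open ≤-Reasoning
  F = 16031 ^ k * 16030
  one : 1 * 10000 ^ k ≤ F
  one = scale-power {1} {16031} {10000} {16030} k 0 (≤ᵇ⇒≤ _ _ tt) z≤n (≤ᵇ⇒≤ _ _ tt)
  lemma : ∀ a → a + a ≡ 1 * (2 * a)
  lemma = solve-∀
κ-bound {G = G} {k} (split k′ 2≤k′ k′≤k P part parts) =
  sum-parts (λ i → κ (G [ P i ])) (λ i → ∣ Graph.V G ∩ P i ∣) {L = length spreadSets} 2≤k′ κ-split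
    -- The quotient has only `k′ ≤ k` vertices; the bound is raised to the exponent `k` common to
    -- the whole tree.
    (scale-power {length spreadSets} {16031} {10000} {16030} k k′ (≤ᵇ⇒≤ _ _ tt) k′≤k spread-bound)
    (λ i → κ-bound (parts i)) ∑-sizes
  where open KappaBound G P part

κ≤ : ∀ {n} {G : Graph n} {k} → MW≤ G k → κ G * 10000 ^ k ≤ ∣ Graph.V G ∣ * (2 * (16031 ^ k * 16030))
κ≤ {G = G} {k} mw = ≤-trans (m≤m+n (κ G * 10000 ^ k) _) (κ-bound mw)

-- Passage to the reals

*-mono-≤-ℚ : ∀ {a b c d} → 0ℚ ℚ.≤ b → 0ℚ ℚ.≤ c → a ℚ.≤ b → c ℚ.≤ d → a ℚ.* c ℚ.≤ b ℚ.* d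
*-mono-≤-ℚ {a} {b} {c} {d} 0≤b 0≤c a≤b c≤d = ℚₚ.≤-trans
  (ℚₚ.*-monoʳ-≤-nonNeg c {{ℚ.nonNegative 0≤c}} a≤b) (ℚₚ.*-monoˡ-≤-nonNeg b {{ℚ.nonNegative 0≤b}} c≤d)

*-pos : ∀ {a b} → 0ℚ ℚ.< a → 0ℚ ℚ.< b → 0ℚ ℚ.< a ℚ.* b
*-pos {a} {b} 0<a 0<b = ℚₚ.positive⁻¹ (a ℚ.* b) {{ℚₚ.pos*pos⇒pos a {{ℚ.positive 0<a}} b {{ℚ.positive 0<b}}}}

ℕ→ℚᵘ : ∀ n → ℚ.toℚᵘ (ℕ→ℚ n) ℚᵘ.≃ ℚᵘ.mkℚᵘ (+ n) 0
ℕ→ℚᵘ n = ℚₚ.toℚᵘ-fromℚᵘ (ℚᵘ.mkℚᵘ (+ n) 0)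

ℕ→ℚ-mono-≤ : ∀ {m n} → m ℕ.≤ n → ℕ→ℚ m ℚ.≤ ℕ→ℚ n
ℕ→ℚ-mono-≤ {m} {n} m≤n = ℚₚ.toℚᵘ-cancel-≤ (ℚᵘₚ.≤-respˡ-≃ (ℚᵘₚ.≃-sym (ℕ→ℚᵘ m)) (ℚᵘₚ.≤-respʳ-≃ (ℚᵘₚ.≃-sym (ℕ→ℚᵘ n))
  (ℚᵘ.*≤* (ℤₚ.*-monoʳ-≤-nonNeg (+ 1) (ℤ.+≤+ m≤n)))))

ℕ→ℚ-homo-* : ∀ m n → ℕ→ℚ (m ℕ.* n) ≡ ℕ→ℚ m ℚ.* ℕ→ℚ n
ℕ→ℚ-homo-* m n = ℚₚ.toℚᵘ-injective (begin
  ℚ.toℚᵘ (ℕ→ℚ (m ℕ.* n))                  ≈⟨ ℕ→ℚᵘ (m ℕ.* n) ⟩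
  ℚᵘ.mkℚᵘ (+ (m ℕ.* n)) 0                 ≈⟨ ℚᵘ.*≡* (cong (ℤ._* + 1) (ℤₚ.pos-* m n)) ⟩
  ℚᵘ.mkℚᵘ (+ m) 0 ℚᵘ.* ℚᵘ.mkℚᵘ (+ n) 0    ≈⟨ ℚᵘₚ.*-cong (ℚᵘₚ.≃-sym (ℕ→ℚᵘ m)) (ℚᵘₚ.≃-sym (ℕ→ℚᵘ n)) ⟩
  ℚ.toℚᵘ (ℕ→ℚ m) ℚᵘ.* ℚ.toℚᵘ (ℕ→ℚ n)      ≈⟨ ℚₚ.toℚᵘ-homo-* (ℕ→ℚ m) (ℕ→ℚ n) ⟨
  ℚ.toℚᵘ (ℕ→ℚ m ℚ.* ℕ→ℚ n)                ∎)
  where open ℚᵘₚ.≃-Reasoning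

ℕ→ℚ-homo-^ : ∀ n k → ℕ→ℚ (n ℕ.^ k) ≡ ℕ→ℚ n ^ℚ k
ℕ→ℚ-homo-^ n zero    = refl
ℕ→ℚ-homo-^ n (suc k) = trans (ℕ→ℚ-homo-* n (n ℕ.^ k)) (cong (ℕ→ℚ n ℚ.*_) (ℕ→ℚ-homo-^ n k))

0≤ℕ→ℚ : ∀ n → 0ℚ ℚ.≤ ℕ→ℚ n
0≤ℕ→ℚ n = ℕ→ℚ-mono-≤ {0} {n} z≤n

0<ℕ→ℚ : ∀ {n} → 1 ℕ.≤ n → 0ℚ ℚ.< ℕ→ℚ n
0<ℕ→ℚ {n} 1≤n = ℚₚ.<-≤-trans (ℚₚ.positive⁻¹ 1ℚ) (ℕ→ℚ-mono-≤ 1≤n)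

^-pos : ∀ {t} → 0ℚ ℚ.< t → ∀ d → 0ℚ ℚ.< t ^ℚ d
^-pos 0<t zero    = ℚₚ.positive⁻¹ 1ℚ
^-pos 0<t (suc d) = *-pos 0<t (^-pos 0<t d)

^-mono-< : ∀ {t x} → 0ℚ ℚ.< t → t ℚ.< x → ∀ d → t ^ℚ suc d ℚ.< x ^ℚ suc d
^-mono-≤ : ∀ {t x} → 0ℚ ℚ.< t → t ℚ.< x → ∀ d → t ^ℚ d ℚ.≤ x ^ℚ d

^-mono-≤ 0<t t<x zero    = ℚₚ.≤-refl
^-mono-≤ 0<t t<x (suc d) = ℚₚ.<⇒≤ (^-mono-< 0<t t<x d)

^-mono-< {t} {x} 0<t t<x d = ℚₚ.<-≤-trans
  (ℚₚ.*-monoˡ-<-pos (t ^ℚ d) {{ℚ.positive (^-pos 0<t d)}} t<x)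
  (ℚₚ.*-monoˡ-≤-nonNeg x {{ℚ.nonNegative (ℚₚ.<⇒≤ (ℚₚ.<-trans 0<t t<x))}} (^-mono-≤ 0<t t<x d))

>1⇒↧<∣↥∣ : ∀ {e} → 1ℚ ℚ.< e → ↧ₙ e ℕ.≤ ℤ.∣ ↥ e ∣
>1⇒↧<∣↥∣ {e} 1<e with ↥ e | ℚₚ.drop-*<* 1<e
... | + m | lt = ℕₚ.<⇒≤ (ℤₚ.drop‿+<+ (subst₂ ℤ._<_ (ℤₚ.*-identityˡ (+ ↧ₙ e)) (ℤₚ.*-identityʳ (+ m)) lt))

-- An exponent `a / d > 1` has `d ≤ a`, so `n ^ d ≤ n ^ a ≤ t ^ d`, which forces `n ≤ t < q`.
Above-^⇒> : ∀ {n} α → 1 ℕ.≤ n → (∀ {e} → Above α e → 1ℚ ℚ.< e) → ∀ {q} → Above (n ^ᴿ α) q → ℕ→ℚ n ℚ.< q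
Above-^⇒> {n} α 1≤n α>1 (e , t , α<e , 0<t , n^e≤t^d , t<q) = ℚₚ.≤-<-trans (ℚₚ.≮⇒≥ t≮n) t<q
  where
  n^d≤t^d : ℕ→ℚ n ^ℚ ↧ₙ e ℚ.≤ t ^ℚ ↧ₙ e
  n^d≤t^d = subst (ℚ._≤ t ^ℚ ↧ₙ e) (ℕ→ℚ-homo-^ n (↧ₙ e))
    (ℚₚ.≤-trans (ℕ→ℚ-mono-≤ (ℕₚ.^-monoʳ-≤ n {{ℕ.>-nonZero 1≤n}} (>1⇒↧<∣↥∣ (α>1 α<e)))) n^e≤t^d)
  t≮n : ¬ t ℚ.< ℕ→ℚ n
  t≮n t<n = ℚₚ.<-irrefl refl (ℚₚ.<-≤-trans (^-mono-< 0<t t<n (ℚ.denominator-1 e)) n^d≤t^d)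

1+ε>1 : ∀ ε {e} → Above (fromℕ 1 +ᴿ ε) e → 1ℚ ℚ.< e
1+ε>1 ε (a , b , 1<a , ε<b , a+b≤e) = ℚₚ.<-≤-trans
  (subst (ℚ._< a ℚ.+ b) (ℚₚ.+-identityʳ 1ℚ) (ℚₚ.+-mono-< 1<a (positive ε ε<b))) a+b≤e

-- A rational above a product dominates a product of rationals above the factors, so the bound
-- `a / b` multiplies; it is stated without division.
Above-^ᴺ⇒≥ : ∀ {x : ℝ≥0} {a b} → (∀ {q} → Above x q → ℕ→ℚ a ℚ.≤ q ℚ.* ℕ→ℚ b) →
             ∀ k {q} → Above (x ^ᴺ k) q → ℕ→ℚ (a ℕ.^ k) ℚ.≤ q ℚ.* ℕ→ℚ (b ℕ.^ k)
Above-^ᴺ⇒≥ x≥ zero {q} 1<q = subst (1ℚ ℚ.≤_) (sym (ℚₚ.*-identityʳ q)) (ℚₚ.<⇒≤ 1<q)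
Above-^ᴺ⇒≥ {x} {a} {b} x≥ (suc k) {q} (r , s , x<r , x^k<s , rs≤q) = begin
  ℕ→ℚ (a ℕ.* a ℕ.^ k)                        ≡⟨ ℕ→ℚ-homo-* a (a ℕ.^ k) ⟩
  ℕ→ℚ a ℚ.* ℕ→ℚ (a ℕ.^ k)                    ≤⟨ *-mono-≤-ℚ (ℚₚ.≤-trans (0≤ℕ→ℚ a) (x≥ x<r)) (0≤ℕ→ℚ (a ℕ.^ k)) (x≥ x<r) (Above-^ᴺ⇒≥ {x} {a} {b} x≥ k x^k<s) ⟩
  (r ℚ.* ℕ→ℚ b) ℚ.* (s ℚ.* ℕ→ℚ (b ℕ.^ k))    ≡⟨ interchange r (ℕ→ℚ b) s (ℕ→ℚ (b ℕ.^ k)) ⟩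
  (r ℚ.* s) ℚ.* (ℕ→ℚ b ℚ.* ℕ→ℚ (b ℕ.^ k))    ≡⟨ cong (r ℚ.* s ℚ.*_) (ℕ→ℚ-homo-* b (b ℕ.^ k)) ⟨
  (r ℚ.* s) ℚ.* ℕ→ℚ (b ℕ.* b ℕ.^ k)          ≤⟨ ℚₚ.*-monoʳ-≤-nonNeg _ {{ℚ.nonNegative (0≤ℕ→ℚ (b ℕ.* b ℕ.^ k))}} rs≤q ⟩
  q ℚ.* ℕ→ℚ (b ℕ.* b ℕ.^ k)                  ∎
  where
  open ℚₚ.≤-Reasoning
  interchange : ∀ w x y z → (w ℚ.* x) ℚ.* (y ℚ.* z) ≡ (w ℚ.* y) ℚ.* (x ℚ.* z)
  interchange w x y z = trans (ℚₚ.*-assoc w x (y ℚ.* z))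
    (trans (cong (w ℚ.*_) (trans (sym (ℚₚ.*-assoc x y z)) (trans (cong (ℚ._* z) (ℚₚ.*-comm x y)) (ℚₚ.*-assoc y x z))))
      (sym (ℚₚ.*-assoc w y (x ℚ.* z))))

-- The strict inequality, which membership in the cut of `fromℕ K` demands, is drawn from `n < b`.
below-product : ∀ {K c A B n} {a₁ a₂ a b q} → 1 ℕ.≤ B → K ℕ.* B ℕ.≤ n ℕ.* (A ℕ.* c) →
                ℕ→ℚ c ℚ.< a₁ → 0ℚ ℚ.< a₂ → ℕ→ℚ A ℚ.≤ a₂ ℚ.* ℕ→ℚ B → a₁ ℚ.* a₂ ℚ.≤ a →
                ℕ→ℚ n ℚ.< b → a ℚ.* b ℚ.≤ q → ℕ→ℚ K ℚ.< q
below-product {K} {c} {A} {B} {n} {a₁} {a₂} {a} {b} {q} 1≤B K≤ c<a₁ 0<a₂ A≤ a₁a₂≤a n<b ab≤q = begin-strict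
  ℕ→ℚ K                    ≤⟨ ℚₚ.*-cancelʳ-≤-pos (ℕ→ℚ B) {{ℚ.positive (0<ℕ→ℚ 1≤B)}} scaled ⟩
  ℕ→ℚ n ℚ.* (a₁ ℚ.* a₂)    ≤⟨ ℚₚ.*-monoˡ-≤-nonNeg (ℕ→ℚ n) {{ℚ.nonNegative (0≤ℕ→ℚ n)}} a₁a₂≤a ⟩
  ℕ→ℚ n ℚ.* a              <⟨ ℚₚ.*-monoˡ-<-pos a {{ℚ.positive 0<a}} n<b ⟩
  b ℚ.* a                  ≡⟨ ℚₚ.*-comm b a ⟩
  a ℚ.* b                  ≤⟨ ab≤q ⟩
  q                        ∎
  where
  open ℚₚ.≤-Reasoning
  0<a₁ : 0ℚ ℚ.< a₁
  0<a₁ = ℚₚ.≤-<-trans (0≤ℕ→ℚ c) c<a₁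
  0<a : 0ℚ ℚ.< a
  0<a = ℚₚ.<-≤-trans (*-pos 0<a₁ 0<a₂) a₁a₂≤a
  0≤a₂B : 0ℚ ℚ.≤ a₂ ℚ.* ℕ→ℚ B
  0≤a₂B = ℚₚ.<⇒≤ (*-pos 0<a₂ (0<ℕ→ℚ 1≤B))
  rearrange : ∀ n x B y → n ℚ.* ((x ℚ.* B) ℚ.* y) ≡ n ℚ.* (y ℚ.* x) ℚ.* B
  rearrange n x B y = trans (cong (n ℚ.*_) (trans (ℚₚ.*-comm (x ℚ.* B) y) (sym (ℚₚ.*-assoc y x B))))
    (sym (ℚₚ.*-assoc n (y ℚ.* x) B))
  scaled : ℕ→ℚ K ℚ.* ℕ→ℚ B ℚ.≤ ℕ→ℚ n ℚ.* (a₁ ℚ.* a₂) ℚ.* ℕ→ℚ B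
  scaled = begin
    ℕ→ℚ K ℚ.* ℕ→ℚ B                            ≡⟨ ℕ→ℚ-homo-* K B ⟨
    ℕ→ℚ (K ℕ.* B)                              ≤⟨ ℕ→ℚ-mono-≤ K≤ ⟩
    ℕ→ℚ (n ℕ.* (A ℕ.* c))                      ≡⟨ trans (ℕ→ℚ-homo-* n (A ℕ.* c)) (cong (ℕ→ℚ n ℚ.*_) (ℕ→ℚ-homo-* A c)) ⟩
    ℕ→ℚ n ℚ.* (ℕ→ℚ A ℚ.* ℕ→ℚ c)                ≤⟨ ℚₚ.*-monoˡ-≤-nonNeg (ℕ→ℚ n) {{ℚ.nonNegative (0≤ℕ→ℚ n)}}
                                                    (*-mono-≤-ℚ 0≤a₂B (0≤ℕ→ℚ c) A≤ (ℚₚ.<⇒≤ c<a₁)) ⟩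
    ℕ→ℚ n ℚ.* ((a₂ ℚ.* ℕ→ℚ B) ℚ.* a₁)          ≡⟨ rearrange (ℕ→ℚ n) a₂ (ℕ→ℚ B) a₁ ⟩
    ℕ→ℚ n ℚ.* (a₁ ℚ.* a₂) ℚ.* ℕ→ℚ B            ∎

base≥ : ∀ {q} → (+ 16031 / 10000) ℚ.< q → ℕ→ℚ 16031 ℚ.≤ q ℚ.* ℕ→ℚ 10000
-- The rational product of 1.6031 and 10000 evaluates to 16031.
base≥ {q} β<q = ℚₚ.≤-trans (ℚₚ.≤-reflexive refl)
  (ℚₚ.*-monoʳ-≤-nonNeg (ℕ→ℚ 10000) (ℚₚ.<⇒≤ β<q))

0<c : fromℕ 0 <ᴿ fromℕ 32060
0<c = 1ℚ , ℚₚ.positive⁻¹ 1ℚ , λ r c<r → ℚₚ.≤-trans (ℕ→ℚ-mono-≤ {1} {32060} (s≤s z≤n)) (ℚₚ.<⇒≤ c<r)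

theorem9 : (ε : ℝ≥0) → fromℕ 0 <ᴿ ε →
    ∃ λ (c : ℝ≥0) → fromℕ 0 <ᴿ c ×
    (∀ {n} (G : Graph n) → Nonempty (Graph.V G) →
    ∀ mw → IsModularWidth G mw →
    fromℕ (κ G) ≤ᴿ c *ᴿ fromℚ (+ 16031 / 10000) ^ᴺ mw *ᴿ ∣ Graph.V G ∣ ^ᴿ (fromℕ 1 +ᴿ ε))
-- 32060 = 2 · 16030: fewer than `2 * ∣ V ∣` nodes in the tree, and the price of absorbing the
-- factor `k`.
theorem9 ε _ = fromℕ 32060 , 0<c , bound
  where
  β : ℝ≥0
  β = fromℚ (+ 16031 / 10000)
  bound : ∀ {n} (G : Graph n) → Nonempty (Graph.V G) → ∀ mw → IsModularWidth G mw →
          fromℕ (κ G) ≤ᴿ fromℕ 32060 *ᴿ β ^ᴺ mw *ᴿ ∣ Graph.V G ∣ ^ᴿ (fromℕ 1 +ᴿ ε)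
  bound G (v , v∈V) mw (mw≤ , _) q (a , b , (a₁ , a₂ , c<a₁ , β^mw<a₂ , a₁a₂≤a) , n<b , ab≤q) =
    below-product {κ G} {32060} {16031 ℕ.^ mw} {10000 ℕ.^ mw} {∣ Graph.V G ∣} (ℕₚ.m^n>0 10000 mw)
      (subst (λ x → κ G ℕ.* 10000 ℕ.^ mw ℕ.≤ ∣ Graph.V G ∣ ℕ.* x) double (κ≤ mw≤))
      c<a₁ (positive (β ^ᴺ mw) β^mw<a₂)
      (Above-^ᴺ⇒≥ {β} {16031} {10000} base≥ mw β^mw<a₂) a₁a₂≤a
      -- A vertex `v` gives `∣ V ∣ ≥ 1`, so that powers of `∣ V ∣` grow with the exponent.
      (Above-^⇒> (fromℕ 1 +ᴿ ε) (ℕₚ.≤-trans (s≤s z≤n) (x∈p⇒∣p-x∣<∣p∣ v∈V)) (1+ε>1 ε) n<b) ab≤q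
    where
    double : 2 ℕ.* (16031 ℕ.^ mw ℕ.* 16030) ≡ 16031 ℕ.^ mw ℕ.* 32060
    double = trans (ℕₚ.*-comm 2 (16031 ℕ.^ mw ℕ.* 16030)) (ℕₚ.*-assoc (16031 ℕ.^ mw) 16030 2)
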